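{- Let $n\ge1$ and let $D_0(n)$ denote either of the checkered diagrams $Ch^1_n$ or $Ch^2_n$. (a) If $n$ is even, then $|Min(D_0(n))|=1$. (b) If $n$ is odd, then $|Min(D_0(n))|=\binom{2m}{m}$, where $m=\lfloor n/2\rfloor$.
   Context: A diagram is a finite set $D$ of cells $(r,c)$ with $r,c$ positive integers; $r$ is the row (rows numbered from bottom to top starting at 1) and $c$ the column (numbered from left to right starting at 1). A Kohnert move at row $r$ applied to a diagram $D$: if row $r$ of $D$ is empty, $D$ is unchanged; otherwise let $(r,c)$ be the cell of row $r$ with the largest column index; if every position $(r',c)$ with $1\le r'<r$ belongs to $D$, then $D$ is unchanged; otherwise let $r'$ be the largest integer with $1\le r'<r$ and $(r',c)\notin D$, and the move replaces the cell $(r,c)$ by $(r',c)$. For a diagram $D_0$, $KD(D_0)$ is the set of all diagrams obtainable from $D_0$ by finite (possibly empty) sequences of Kohnert moves; the Kohnert poset $\mathcal{P}(D_0)$ is $KD(D_0)$ ordered by $D_2\preceq D_1$ iff $D_2$ can be obtained from $D_1$ by a finite sequence of Kohnert moves; $Min(D_0)$ is the set of its minimal elements. Checkered diagrams: $Ch^1_n=\{(2i-1,2j-1):1\le i,j\le\lceil n/2\rceil\}\cup\{(2i,2j):1\le i,j\le\lfloor n/2\rfloor\}$ and $Ch^2_n=\{(2i-1,2j):1\le i\le\lceil n/2\rceil,\ 1\le j\le\lfloor n/2\rfloor\}\cup\{(2i,2j-1):1\le i\le\lfloor n/2\rfloor,\ 1\le j\le\lceil n/2\rceil\}$. -}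

module Defs where

open import Data.Nat using (ℕ; zero; suc; _∸_; _+_; _*_; _⊔_; ⌊_/2⌋; ⌈_/2⌉; _≟_)
open import Data.Nat.Combinatorics using (_C_)
open import Data.Product using (_×_; _,_; proj₁; proj₂; Σ; ∃)
open import Data.Product.Properties using (≡-dec)
open import Data.List using (List; []; _∷_; map; filter; foldr; length; concatMap; upTo)
open import Data.List.Membership.Propositional using (_∈_)
open import Data.List.Relation.Unary.All using (All)
open import Data.List.Relation.Unary.Any using (Any)
open import Data.List.Relation.Unary.AllPairs using (AllPairs)
open import Data.Maybe using (Maybe; just; nothing)
open import Data.Bool using (if_then_else_)
open import Relation.Nullary using (¬_; ¬?; does)
open import Relation.Binary.PropositionalEquality using (_≡_)
open import Function.Bundles using (_⇔_)

-- A cell (r , c): r = row (counted from bottom, starting at 1),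
-- c = column (counted from left, starting at 1).
Cell : Set
Cell = ℕ × ℕ

-- A diagram is a finite set of cells, represented by a list of cells;
-- two lists denote the same diagram iff they have the same members.
Diagram : Set
Diagram = List Cell

_≟ᶜ_ : (x y : Cell) → Relation.Nullary.Dec (x ≡ y)
_≟ᶜ_ = ≡-dec _≟_ _≟_

open import Data.List.Membership.DecPropositional _≟ᶜ_ using (_∈?_)

_≈D_ : Diagram → Diagram → Set
D ≈D E = (x : Cell) → (x ∈ D) ⇔ (x ∈ E)

rowCells : ℕ → Diagram → Diagram
rowCells r D = filter (λ x → proj₁ x ≟ r) D

maxCol : Diagram → ℕ
maxCol D = foldr (λ x m → proj₂ x ⊔ m) 0 D

findFree : ℕ → ℕ → Diagram → Maybe ℕ
findFree zero    c D = nothing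
findFree (suc k) c D =
  if does ((suc k , c) ∈? D) then findFree k c D else just (suc k)

moveAt : ℕ → ℕ → Diagram → Diagram
moveAt r c D with findFree (r ∸ 1) c D
... | nothing = D
... | just r′ = (r′ , c) ∷ filter (λ x → ¬? (x ≟ᶜ (r , c))) D

kohnert : ℕ → Diagram → Diagram
kohnert r D with rowCells r D
... | []        = D
... | row@(_ ∷ _) = moveAt r (maxCol row) D

data _⇝_ : Diagram → Diagram → Set where
  done : ∀ {D} → D ⇝ D
  step : ∀ {D E} (r : ℕ) → kohnert r D ⇝ E → D ⇝ E

_≼_ : Diagram → Diagram → Set
D₂ ≼ D₁ = Σ Diagram λ E → (D₁ ⇝ E) × (E ≈D D₂)

InKD : Diagram → Diagram → Set
InKD D₀ D = D ≼ D₀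

IsMin : Diagram → Diagram → Set
IsMin D₀ D = InKD D₀ D × ((D′ : Diagram) → D′ ≼ D → D′ ≈D D)

MinCard : Diagram → ℕ → Set
MinCard D₀ k = Σ (List Diagram) λ L →
  (length L ≡ k) × All (IsMin D₀) L ×
  AllPairs (λ D E → ¬ (D ≈D E)) L ×
  ((D : Diagram) → IsMin D₀ D → Any (D ≈D_) L)

range1 : ℕ → List ℕ
range1 k = map suc (upTo k)

grid : (ℕ → ℕ) → (ℕ → ℕ) → ℕ → ℕ → Diagram
grid f g a b = concatMap (λ i → map (λ j → (f i , g j)) (range1 b)) (range1 a)

odd′ even′ : ℕ → ℕ
odd′ i = 2 * i ∸ 1
even′ i = 2 * i

Ch¹ : ℕ → Diagram
Ch¹ n = grid odd′ odd′ ⌈ n /2⌉ ⌈ n /2⌉ Data.List.++ grid even′ even′ ⌊ n /2⌋ ⌊ n /2⌋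

Ch² : ℕ → Diagram
Ch² n = grid odd′ even′ ⌈ n /2⌉ ⌊ n /2⌋ Data.List.++ grid even′ odd′ ⌊ n /2⌋ ⌈ n /2⌉

{-# OPTIONS --safe #-}

-- Let m = ⌊ n /2⌋. A diagram is minimal iff the rightmost cell of every row rests on a full
-- column. Moves preserve the number of cells of each column, and for columns c < c′ they
-- preserve the relation "every initial segment of column c′ contains at least as many cells as
-- that of column c". For even n all columns hold m cells and the only minimal diagram is the
-- rectangle. For odd n a minimal diagram lies in the rows 1,…,1+m, the columns with 1+m cells
-- are full, and each remaining one misses a single cell, its hole; by the preserved relation
-- the holes weakly increase from left to right, and a hole in column n is in row 1+m. This
-- leaves the weakly increasing sequences of length m in {1,…,1+m}, of which there are 2m choose m.
-- Each of them is reached by completing the rows from the bottom: row 2+2i falls to row 2+i,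
-- its cells whose hole lies above row 1+i drop on to row 1+i, and row 3+2i follows to row 2+i.
module Submission where

open import Defs
open import Data.Bool using (Bool; true; false; T; not; _∧_; _∨_; _xor_; if_then_else_)
open import Data.Bool.Properties using (∨-identityʳ; ∧-zeroʳ; ∧-identityʳ; not-involutive)
  renaming (_≟_ to _≟ᵇ_)
open import Data.Empty using (⊥; ⊥-elim)
open import Data.List
  using (List; []; _∷_; _++_; map; filter; length; upTo; applyUpTo; cartesianProduct)
open import Data.List.Membership.DecPropositional _≟ᶜ_ using (_∈?_)
open import Data.List.Membership.Propositional using (_∈_; find; lose)
open import Data.List.Membership.Propositional.Properties
  using (∈-map⁺; ∈-map⁻; ∈-++⁺ˡ; ∈-++⁺ʳ; ∈-++⁻; ∈-filter⁺; ∈-filter⁻; ∈-concatMap⁺; ∈-concatMap⁻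
        ; ∈-cartesianProduct⁺; ∈-upTo⁺; ∈-upTo⁻)
open import Data.List.Properties using (length-map; length-++; length-applyUpTo; ∷-injectiveʳ)
open import Data.List.Relation.Unary.All using (All; []; _∷_)
import Data.List.Relation.Unary.All as All
import Data.List.Relation.Unary.All.Properties as All
open import Data.List.Relation.Unary.AllPairs using (AllPairs; []; _∷_)
import Data.List.Relation.Unary.AllPairs.Properties as AllPairs
open import Data.List.Relation.Unary.Any using (here; there)
import Data.List.Relation.Unary.Any as Any
import Data.List.Relation.Unary.Any.Properties as Any
open import Data.List.Relation.Unary.Unique.Propositional using (Unique)
import Data.List.Relation.Unary.Unique.Propositional.Properties as Unique
open import Data.Maybe using (Maybe; just; nothing)
open import Data.Nat
open import Data.Nat.Combinatorics using (_C_; nCn≡1; nCk+nC[k+1]≡[n+1]C[k+1])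
open import Data.Nat.Properties
open import Data.Product using (_×_; _,_; proj₁; proj₂; ∃-syntax)
open import Data.Sum using (_⊎_; inj₁; inj₂; [_,_]′)
open import Function.Base using (_∘_)
open import Function.Bundles using (mk⇔; Equivalence)
open import Relation.Binary.Definitions using (tri<; tri≈; tri>)
open import Relation.Binary.PropositionalEquality
open import Relation.Nullary using (¬_; ¬?; does; yes; no)
open import Relation.Nullary.Decidable using (dec-true; dec-false)

-- Kohnert moves through membership functions

true≢false : ∀ {b} → b ≡ true → b ≡ false → ⊥
true≢false p q with () ← trans (sym p) q

≢true⇒false : ∀ {b} → (b ≡ true → ⊥) → b ≡ false
≢true⇒false {false} _ = refl
≢true⇒false {true}  p = ⊥-elim (p refl)

Bool-ext : ∀ {a b} → (a ≡ true → b ≡ true) → (b ≡ true → a ≡ true) → a ≡ b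
Bool-ext {true}  f g = sym (f refl)
Bool-ext {false} f g = sym (≢true⇒false (λ p → true≢false (g p) refl))

-- Diagrams are compared through a Boolean membership function, so that `≈D` becomes pointwise
-- equality. Opacity keeps `mem D r c` a single term for `rewrite` and `with`.
opaque
  mem : Diagram → ℕ → ℕ → Bool
  mem D r c = does ((r , c) ∈? D)

  mem⁺ : ∀ {D r c} → (r , c) ∈ D → mem D r c ≡ true
  mem⁺ {D} {r} {c} = dec-true ((r , c) ∈? D)

  mem⁻ : ∀ {D r c} → mem D r c ≡ true → (r , c) ∈ D
  mem⁻ {D} {r} {c} p with yes q ← (r , c) ∈? D = q

≈D⇒mem : ∀ {D E} → D ≈D E → ∀ r c → mem D r c ≡ mem E r c
≈D⇒mem e r c = Bool-ext (mem⁺ ∘ Equivalence.to (e _) ∘ mem⁻) (mem⁺ ∘ Equivalence.from (e _) ∘ mem⁻)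

mem⇒≈D : ∀ {D E} → (∀ r c → mem D r c ≡ mem E r c) → D ≈D E
mem⇒≈D e (r , c) = mk⇔ (λ p → mem⁻ (trans (sym (e r c)) (mem⁺ p))) (λ p → mem⁻ (trans (e r c) (mem⁺ p)))

⇝-trans : ∀ {D E F} → D ⇝ E → E ⇝ F → D ⇝ F
⇝-trans done       q = q
⇝-trans (step r p) q = step r (⇝-trans p q)

Rightmost : Diagram → ℕ → ℕ → Set
Rightmost D r c = mem D r c ≡ true × (∀ c′ → c < c′ → mem D r c′ ≡ false)

-- Describes a move by membership alone, so that no later argument inspects the lists. That the cell
-- is the rightmost of its row is recorded separately by `Rightmost`.
record Falls (D : Diagram) (r r′ c : ℕ) (E : Diagram) : Set where
  field
    positive : 1 ≤ r′
    lower    : r′ < r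
    source   : mem D r c ≡ true
    vacant   : mem D r′ c ≡ false
    between  : ∀ s → r′ < s → s < r → mem D s c ≡ true
    target   : mem E r′ c ≡ true
    vacated  : mem E r c ≡ false
    others   : ∀ s → s ≢ r → s ≢ r′ → mem E s c ≡ mem D s c
    columns  : ∀ s c′ → c′ ≢ c → mem E s c′ ≡ mem D s c′

data FreeView (D : Diagram) (c k : ℕ) : Maybe ℕ → Set where
  full : (∀ s → 1 ≤ s → s ≤ k → mem D s c ≡ true) → FreeView D c k nothing
  free : ∀ {r} → 1 ≤ r → r ≤ k → mem D r c ≡ false →
         (∀ s → r < s → s ≤ k → mem D s c ≡ true) → FreeView D c k (just r)

opaque
  -- Unfolded so that the test performed by `findFree` is recognised as `mem D (suc k) c`.
  unfolding mem

  findFree-view : ∀ k c D → FreeView D c k (findFree k c D)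
  findFree-view zero    c D = full λ { _ (s≤s _) () }
  findFree-view (suc k) c D with mem D (suc k) c in eq | findFree k c D | findFree-view k c D
  ... | false | _ | _ = free (s≤s z≤n) ≤-refl eq λ s p q → ⊥-elim (<⇒≱ p q)
  ... | true  | nothing | full f = full λ s p q → extend s q (f s p)
    where
    extend : ∀ s → s ≤ suc k → (s ≤ k → mem D s c ≡ true) → mem D s c ≡ true
    extend s q g with m≤n⇒m<n∨m≡n q
    ... | inj₁ (s≤s s≤k) = g s≤k
    ... | inj₂ refl = eq
  ... | true  | just r | free p q v f = free p (m≤n⇒m≤1+n q) v λ s r<s q′ → extend s q′ (f s r<s)
    where
    extend : ∀ s → s ≤ suc k → (s ≤ k → mem D s c ≡ true) → mem D s c ≡ true
    extend s q g with m≤n⇒m<n∨m≡n q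
    ... | inj₁ (s≤s s≤k) = g s≤k
    ... | inj₂ refl = eq

-- The result is an index: matching on `empty` or `blocked` identifies it with `D`, and only `moved`
-- leaves something to prove.
data MoveView (D : Diagram) (r : ℕ) : Diagram → Set where
  empty   : (∀ c → mem D r c ≡ false) → MoveView D r D
  blocked : ∀ c → Rightmost D r c → (∀ s → 1 ≤ s → s < r → mem D s c ≡ true) → MoveView D r D
  moved   : ∀ {E} r′ c → Rightmost D r c → Falls D r r′ c E → MoveView D r E

replace-falls : ∀ {D r r′ c} → mem D r c ≡ true → 1 ≤ r′ → r′ < r → mem D r′ c ≡ false →
  (∀ s → r′ < s → s < r → mem D s c ≡ true) →
  Falls D r r′ c ((r′ , c) ∷ filter (λ x → ¬? (x ≟ᶜ (r , c))) D)
replace-falls {D} {r} {r′} {c} src pos low vac btw = record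
  { positive = pos ; lower = low ; source = src ; vacant = vac ; between = btw
  ; target   = mem⁺ (here refl)
  ; vacated  = ≢true⇒false gone
  ; others   = λ s s≢r s≢r′ → unchanged s c (s≢r ∘ cong proj₁) (s≢r′ ∘ cong proj₁)
  ; columns  = λ s c′ c′≢c → unchanged s c′ (c′≢c ∘ cong proj₂) (c′≢c ∘ cong proj₂)
  }
  where
  E = (r′ , c) ∷ filter (λ x → ¬? (x ≟ᶜ (r , c))) D
  gone : mem E r c ≡ true → ⊥
  gone p with mem⁻ {E} p
  ... | here refl = <-irrefl refl low
  ... | there q = proj₂ (∈-filter⁻ (λ x → ¬? (x ≟ᶜ (r , c))) {xs = D} q) refl
  unchanged : ∀ s c′ → (s , c′) ≢ (r , c) → (s , c′) ≢ (r′ , c) → mem E s c′ ≡ mem D s c′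
  unchanged s c′ ≢src ≢tgt = Bool-ext fwd bwd
    where
    fwd : mem E s c′ ≡ true → mem D s c′ ≡ true
    fwd p with mem⁻ {E} p
    ... | here q = ⊥-elim (≢tgt q)
    ... | there q = mem⁺ (proj₁ (∈-filter⁻ (λ x → ¬? (x ≟ᶜ (r , c))) {xs = D} q))
    bwd : mem D s c′ ≡ true → mem E s c′ ≡ true
    bwd p = mem⁺ {E} (there (∈-filter⁺ (λ x → ¬? (x ≟ᶜ (r , c))) (mem⁻ p) ≢src))

moveAt-view : ∀ r c D → Rightmost D r c → MoveView D r (moveAt r c D)
-- Moves at row 0 are allowed by `_⇝_`. They do nothing, since no row lies below.
moveAt-view zero    c D R = blocked c R λ _ _ ()
moveAt-view (suc k) c D R with findFree k c D | findFree-view k c D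
... | nothing | full f = blocked c R λ { s p (s≤s q) → f s p q }
... | just r′ | free pos low vac btw = moved r′ c R
  (replace-falls (proj₁ R) pos (s≤s low) vac λ { s p (s≤s q) → btw s p q })

maxCol-upper : ∀ {x} D → x ∈ D → proj₂ x ≤ maxCol D
maxCol-upper (x ∷ D) (here refl) = m≤m⊔n (proj₂ x) (maxCol D)
maxCol-upper (y ∷ D) (there p) = ≤-trans (maxCol-upper D p) (m≤n⊔m (proj₂ y) (maxCol D))

maxCol-attained : ∀ x D → ∃[ y ] (y ∈ x ∷ D × proj₂ y ≡ maxCol (x ∷ D))
maxCol-attained x [] = x , here refl , sym (⊔-identityʳ (proj₂ x))
maxCol-attained x (y ∷ D) with ⊔-sel (proj₂ x) (maxCol (y ∷ D))
... | inj₁ p = x , here refl , sym p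
... | inj₂ p with z , z∈ , q ← maxCol-attained y D = z , there z∈ , trans q (sym p)

rowCells-∈⁺ : ∀ {r c} D → (r , c) ∈ D → (r , c) ∈ rowCells r D
rowCells-∈⁺ {r} D p = ∈-filter⁺ (λ x → proj₁ x ≟ r) p refl

rowCells-∈⁻ : ∀ {r x} D → x ∈ rowCells r D → x ∈ D × proj₁ x ≡ r
rowCells-∈⁻ {r} D = ∈-filter⁻ (λ x → proj₁ x ≟ r) {xs = D}

maxCol-rightmost : ∀ {r x xs} D → rowCells r D ≡ x ∷ xs → Rightmost D r (maxCol (x ∷ xs))
maxCol-rightmost {r} {x} {xs} D eq with y , y∈ , max ← maxCol-attained x xs
  with y∈D , refl ← rowCells-∈⁻ {r} D (subst (y ∈_) (sym eq) y∈)
  = subst (λ c → mem D r c ≡ true) max (mem⁺ y∈D)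
  , λ c′ lt → ≢true⇒false λ p →
      <⇒≱ lt (maxCol-upper (x ∷ xs) (subst ((r , c′) ∈_) eq (rowCells-∈⁺ D (mem⁻ p))))

kohnert-view : ∀ r D → MoveView D r (kohnert r D)
kohnert-view r D with rowCells r D in eq
... | [] = empty λ c → ≢true⇒false λ p → nothing-in (subst ((r , c) ∈_) eq (rowCells-∈⁺ D (mem⁻ p)))
  where
  nothing-in : ∀ {x : Cell} → x ∈ [] → ⊥
  nothing-in ()
... | x ∷ xs = moveAt-view r (maxCol (x ∷ xs)) D (maxCol-rightmost D eq)

rightmost-unique : ∀ {D r c c′} → Rightmost D r c → Rightmost D r c′ → c ≡ c′
rightmost-unique {c = c} {c′} (p , f) (p′ , f′) with <-cmp c c′
... | tri< lt _ _ = ⊥-elim (true≢false p′ (f c′ lt))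
... | tri≈ _ e _ = e
... | tri> _ _ gt = ⊥-elim (true≢false p (f′ c gt))

-- The move at row `r` already searches for this cell: both outcomes for a nonempty row carry it.
rightmost-exists : ∀ {D r c} → mem D r c ≡ true → ∃[ c′ ] Rightmost D r c′
rightmost-exists {D} {r} {c} p with kohnert r D | kohnert-view r D
... | _ | empty f = ⊥-elim (true≢false p (f c))
... | _ | blocked c′ R _ = c′ , R
... | _ | moved _ c′ R _ = c′ , R

-- A landing row below `r` would make row `r` one of the occupied rows jumped over, against its
-- vacancy.
kohnert-down : ∀ {D r c} → 1 ≤ r → Rightmost D (suc r) c → mem D r c ≡ false →
  Falls D (suc r) r c (kohnert (suc r) D)
kohnert-down {D} {r} {c} 1≤r R vac with kohnert (suc r) D | kohnert-view (suc r) D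
... | _ | empty f = ⊥-elim (true≢false (proj₁ R) (f c))
... | _ | blocked c′ R′ f with refl ← rightmost-unique R R′ = ⊥-elim (true≢false (f r 1≤r ≤-refl) vac)
... | _ | moved r′ c′ R′ F with refl ← rightmost-unique R R′ with m≤n⇒m<n∨m≡n (s≤s⁻¹ (Falls.lower F))
...   | inj₁ lt = ⊥-elim (true≢false (Falls.between F r lt ≤-refl) vac)
...   | inj₂ refl = F

-- Minimality as stability under every single move.

Stable : Diagram → Set
Stable D = ∀ {r c} → Rightmost D r c → ∀ s → 1 ≤ s → s < r → mem D s c ≡ true

Stable⇒⇝-≡ : ∀ {D E} → Stable D → D ⇝ E → E ≡ D
Stable⇒⇝-≡ st done = refl
Stable⇒⇝-≡ {D} st (step r p) with kohnert r D | kohnert-view r D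
... | _ | empty _ = Stable⇒⇝-≡ st p
... | _ | blocked _ _ _ = Stable⇒⇝-≡ st p
... | _ | moved r′ c R F =
  ⊥-elim (true≢false (st R r′ (Falls.positive F) (Falls.lower F)) (Falls.vacant F))

Stable⇒IsMin : ∀ {D₀ D} → InKD D₀ D → Stable D → IsMin D₀ D
Stable⇒IsMin {D₀} {D} D∈KD st = D∈KD , λ D′ (E , D⇝E , E≈D′) x →
  let e = subst (_≈D D′) (Stable⇒⇝-≡ st D⇝E) E≈D′ x in mk⇔ (Equivalence.from e) (Equivalence.to e)

≈D-refl : ∀ D → D ≈D D
≈D-refl D x = mk⇔ (λ p → p) (λ p → p)

-- Minimality is applied to one move at row `r`. A cell that really fell would vacate its source, so
-- the result would have other members than `D`.
IsMin⇒Stable : ∀ {D₀ D} → IsMin D₀ D → Stable D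
IsMin⇒Stable {D₀} {D} (_ , least) {r} {c} R s 1≤s s<r
  with kohnert r D | kohnert-view r D | least (kohnert r D) (kohnert r D , step r done , ≈D-refl _)
... | _ | empty f | _ = ⊥-elim (true≢false (proj₁ R) (f c))
... | _ | blocked c′ R′ f | _ with refl ← rightmost-unique R R′ = f s 1≤s s<r
... | _ | moved r′ c′ R′ F | e =
  ⊥-elim (true≢false (Falls.source F) (trans (sym (≈D⇒mem e r c′)) (Falls.vacated F)))

-- Cell counts of columns

bit : Bool → ℕ
bit true  = 1
bit false = 0

bit≤1 : ∀ b → bit b ≤ 1
bit≤1 true  = s≤s z≤n
bit≤1 false = z≤n

count : (ℕ → Bool) → ℕ → ℕ
count f zero    = 0
count f (suc k) = bit (f (suc k)) + count f k

count-cong : ∀ {f g} k → (∀ s → 1 ≤ s → s ≤ k → f s ≡ g s) → count f k ≡ count g k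
count-cong zero    e = refl
count-cong (suc k) e =
  cong₂ _+_ (cong bit (e (suc k) (s≤s z≤n) ≤-refl)) (count-cong k λ s p q → e s p (m≤n⇒m≤1+n q))

count-suc-true : ∀ {f} k → f (suc k) ≡ true → count f (suc k) ≡ suc (count f k)
count-suc-true k p rewrite p = refl

count-suc-false : ∀ {f} k → f (suc k) ≡ false → count f (suc k) ≡ count f k
count-suc-false k p rewrite p = refl

count-≤ : ∀ f k → count f k ≤ k
count-≤ f zero    = z≤n
count-≤ f (suc k) = +-mono-≤ (bit≤1 (f (suc k))) (count-≤ f k)

count-mono : ∀ f {j k} → j ≤ k → count f j ≤ count f k
count-mono f {k = zero} z≤n = z≤n
count-mono f {j} {suc k} j≤ with m≤n⇒m<n∨m≡n j≤
... | inj₁ (s≤s j≤k) = ≤-trans (count-mono f j≤k) (m≤n+m (count f k) _)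
... | inj₂ refl = ≤-refl

count-full : ∀ f k → (∀ s → 1 ≤ s → s ≤ k → f s ≡ true) → count f k ≡ k
count-full f zero    _ = refl
count-full f (suc k) t = trans (count-suc-true k (t (suc k) (s≤s z≤n) ≤-refl))
  (cong suc (count-full f k λ s p q → t s p (m≤n⇒m≤1+n q)))

count-empty : ∀ f k → (∀ s → 1 ≤ s → s ≤ k → f s ≡ false) → count f k ≡ 0
count-empty f zero    _ = refl
count-empty f (suc k) t = trans (count-suc-false k (t (suc k) (s≤s z≤n) ≤-refl))
  (count-empty f k λ s p q → t s p (m≤n⇒m≤1+n q))

count-empty⁻ : ∀ f k → count f k ≡ 0 → ∀ s → 1 ≤ s → s ≤ k → f s ≡ false
count-empty⁻ f (suc k) e s 1≤s s≤ with f (suc k) in eq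
... | false with m≤n⇒m<n∨m≡n s≤
...   | inj₁ (s≤s s≤k) = count-empty⁻ f k e s 1≤s s≤k
...   | inj₂ refl = eq
count-empty⁻ f zero e (suc s) 1≤s ()

count-full⁻ : ∀ f k → count f k ≡ k → ∀ s → 1 ≤ s → s ≤ k → f s ≡ true
count-full⁻ f zero    e (suc s) 1≤s ()
count-full⁻ f (suc k) e s 1≤s s≤ with f (suc k) in eq
... | false = ⊥-elim (<⇒≱ (≤-reflexive (sym e)) (count-≤ f k))
... | true with m≤n⇒m<n∨m≡n s≤
...   | inj₁ (s≤s s≤k) = count-full⁻ f k (suc-injective e) s 1≤s s≤k
...   | inj₂ refl = eq

count-stationary : ∀ f {j k} → j ≤ k → (∀ s → j < s → s ≤ k → f s ≡ false) → count f k ≡ count f j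
count-stationary f {k = zero} z≤n _ = refl
count-stationary f {j} {suc k} j≤ e with m≤n⇒m<n∨m≡n j≤
... | inj₁ (s≤s j≤k) = trans (count-suc-false k (e (suc k) (s≤s j≤k) ≤-refl))
  (count-stationary f j≤k λ s p q → e s p (m≤n⇒m≤1+n q))
... | inj₂ refl = refl

-- Searches downwards from row `k`. The value 0 stands for "no hole", as rows start at 1.
hole : (ℕ → Bool) → ℕ → ℕ
hole f zero    = 0
hole f (suc k) = if f (suc k) then hole f k else suc k

record OneHole (f : ℕ → Bool) (k h : ℕ) : Set where
  field
    positive : 1 ≤ h
    bounded  : h ≤ k
    vacant   : f h ≡ false
    others   : ∀ s → 1 ≤ s → s ≤ k → s ≢ h → f s ≡ true

-- If the top row is vacant, the `k` rows below hold `k` cells and are full. Otherwise removing the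
-- top cell leaves the same situation one row lower.
hole-spec : ∀ f k → count f (suc k) ≡ k → OneHole f (suc k) (hole f (suc k))
hole-spec f k e with f (suc k) in eq
... | false = record
  { positive = s≤s z≤n ; bounded = ≤-refl ; vacant = eq
  ; others = λ s p q s≢ → count-full⁻ f k e s p (s≤s⁻¹ (≤∧≢⇒< q s≢)) }
hole-spec f (suc k) e | true = record
  { positive = positive ; bounded = m≤n⇒m≤1+n bounded ; vacant = vacant ; others = others′ }
  where
  open OneHole (hole-spec f k (suc-injective e))
  others′ : ∀ s → 1 ≤ s → s ≤ suc (suc k) → s ≢ hole f (suc k) → f s ≡ true
  others′ s p q s≢ with m≤n⇒m<n∨m≡n q
  ... | inj₁ (s≤s q′) = others s p q′ s≢
  ... | inj₂ refl = eq

-- Dominance between columns.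

Dominated : (ℕ → Bool) → (ℕ → Bool) → Set
Dominated f g = ∀ k → count f k ≤ count g k

-- If `h′ < h`, then `f` is full up to row `h′` while `g` misses that row, so `f` is ahead there and
-- dominance fails.
hole-mono : ∀ {f g k h h′} → OneHole f k h → OneHole g k h′ → Dominated f g → h ≤ h′
hole-mono {f} {g} {k} {h} {h′} F G dom with h ≤? h′
... | yes p = p
... | no h≰h′ with h′
...   | zero with () ← OneHole.positive G
...   | suc p = ⊥-elim (<⇒≱ (≤-trans below (dom (suc p))) behind)
  where
  below : suc p ≤ count f (suc p)
  below = ≤-reflexive (sym (count-full f (suc p) λ s 1≤s s≤ →
    OneHole.others F s 1≤s (≤-trans s≤ (OneHole.bounded G)) λ { refl → h≰h′ s≤ }))
  behind : count g (suc p) ≤ p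
  behind = subst (_≤ p) (sym (count-suc-false p (OneHole.vacant G))) (count-≤ g p)

column : Diagram → ℕ → ℕ → Bool
column D c s = mem D s c

module _ {D r r′ c E} (F : Falls D r r′ c E) where
  open Falls F

  private
    f = column D c
    f′ = column E c

  count-below : ∀ {k} → k < r′ → count f′ k ≡ count f k
  count-below {k} k<r′ = count-cong k λ s _ s≤k →
    let s<r′ = ≤-<-trans s≤k k<r′ in others s (<⇒≢ (<-trans s<r′ lower)) (<⇒≢ s<r′)

  count-inside : ∀ {k} → r′ ≤ k → k < r → count f′ k ≡ suc (count f k)
  count-inside {zero} r′≤k _ = ⊥-elim (<⇒≱ positive r′≤k)
  count-inside {suc k} r′≤ k<r with m≤n⇒m<n∨m≡n r′≤
  ... | inj₁ (s≤s r′≤k) rewrite others (suc k) (<⇒≢ k<r) (≢-sym (<⇒≢ (s≤s r′≤k)))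
                        | count-inside r′≤k (<-trans (n<1+n k) k<r)
                        = +-suc _ _
  ... | inj₂ refl = trans (count-suc-true k target)
    (cong suc (trans (count-below (n<1+n k)) (sym (count-suc-false k vacant))))

  -- From row `r` on, the gain at `r′` and the loss at `r` cancel. This is why column totals are
  -- preserved.
  count-above : ∀ {k} → r ≤ k → count f′ k ≡ count f k
  count-above {zero} r≤k = ⊥-elim (n≮0 (<-≤-trans lower r≤k))
  count-above {suc k} r≤ with m≤n⇒m<n∨m≡n r≤
  ... | inj₁ (s≤s r≤k) = cong₂ _+_
    (cong bit (others (suc k) (≢-sym (<⇒≢ (s≤s r≤k))) (≢-sym (<⇒≢ (<-≤-trans lower r≤)))))
    (count-above r≤k)
  ... | inj₂ refl = trans (count-suc-false k vacated)
    (trans (count-inside (s≤s⁻¹ lower) (n<1+n k)) (sym (count-suc-true k source)))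

  count-increases : ∀ k → count f k ≤ count f′ k
  count-increases k with k <? r′ | k <? r
  ... | yes p | _ = ≤-reflexive (sym (count-below p))
  ... | no p | yes q = ≤-trans (n≤1+n _) (≤-reflexive (sym (count-inside (≮⇒≥ p) q)))
  ... | no p | no q = ≤-reflexive (sym (count-above (≮⇒≥ q)))

  -- A column that meets row r outside the dominating column g lags strictly behind g
  -- just below r, hence along the whole block of cells that the falling cell jumps over.
  count-strict : ∀ {g} → Dominated f g → g r ≡ false → ∀ k → r′ ≤ k → k < r → count f k < count g k
  count-strict {g} dom g-r k r′≤k k<r = go (r ∸ suc k) k r′≤k (m∸n+n≡m k<r)
    where
    -- Induction downwards from row `r`, with `d` the distance from `suc k` to `r`. At `r` the
    -- column `f` has a cell and `g` has none; lower in the block each row gives `f` a cell and `g`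
    -- at most one.
    go : ∀ d k → r′ ≤ k → d + suc k ≡ r → count f k < count g k
    go zero k r′≤k refl = subst₂ _≤_ (count-suc-true k source) (count-suc-false k g-r) (dom (suc k))
    go (suc d) k r′≤k e = s≤s⁻¹ (begin
      suc (suc (count f k))               ≡⟨ cong suc (count-suc-true k in-block) ⟨
      suc (count f (suc k))               ≤⟨ go d (suc k) (m≤n⇒m≤1+n r′≤k) (trans (+-suc d (suc k)) e) ⟩
      bit (g (suc k)) + count g k         ≤⟨ +-monoˡ-≤ (count g k) (bit≤1 (g (suc k))) ⟩
      suc (count g k)                     ∎)
      where
      open ≤-Reasoning
      in-block : mem D (suc k) c ≡ true
      in-block = between (suc k) (s≤s r′≤k) (subst (suc k <_) e (s≤s (m≤n+m (suc k) d)))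

  -- The count of `f` grows only for `r′ ≤ k < r`, and there only by one, which the strict
  -- inequality of `count-strict` absorbs.
  dominated-left : ∀ {g} → Dominated f g → g r ≡ false → Dominated f′ g
  dominated-left {g} dom g-r k with k <? r′ | k <? r
  ... | yes p | _ = subst (_≤ count g k) (sym (count-below p)) (dom k)
  ... | no p | yes q = subst (_≤ count g k) (sym (count-inside (≮⇒≥ p) q)) (count-strict dom g-r k (≮⇒≥ p) q)
  ... | no p | no q = subst (_≤ count g k) (sym (count-above (≮⇒≥ q))) (dom k)

column-count-cong : ∀ {D E c} → (∀ s → mem E s c ≡ mem D s c) → ∀ k → count (column E c) k ≡ count (column D c) k
column-count-cong e k = count-cong k λ s _ _ → e s

-- If the falling cell lies in column `c`, row `r` of column `c′` is vacant because the cell is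
-- rightmost, and `dominated-left` applies. Otherwise column `c` is unchanged and the initial
-- segments of `c′` can only gain.
⇝-dominated : ∀ {D E c c′} → D ⇝ E → c < c′ →
  Dominated (column D c) (column D c′) → Dominated (column E c) (column E c′)
⇝-dominated done _ dom = dom
⇝-dominated {D} {c = c} {c′} (step r p) c<c′ dom with kohnert r D | kohnert-view r D
... | _ | empty _ = ⇝-dominated p c<c′ dom
... | _ | blocked _ _ _ = ⇝-dominated p c<c′ dom
... | E | moved r′ a R F = ⇝-dominated p c<c′ dom′
  where
  dom′ : Dominated (column E c) (column E c′)
  dom′ k with a ≟ c
  ... | yes refl = subst (count (column E c) k ≤_)
    (sym (column-count-cong (λ s → Falls.columns F s c′ (≢-sym (<⇒≢ c<c′))) k))
    (dominated-left F dom (proj₂ R c′ c<c′) k)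
  ... | no a≢c = subst (_≤ count (column E c′) k)
    (sym (column-count-cong (λ s → Falls.columns F s c (≢-sym a≢c)) k)) (≤-trans (dom k) (right k))
    where
    right : ∀ k → count (column D c′) k ≤ count (column E c′) k
    right k with a ≟ c′
    ... | yes refl = count-increases F k
    ... | no a≢c′ = ≤-reflexive (sym (column-count-cong (λ s → Falls.columns F s c′ (≢-sym a≢c′)) k))

-- Row bounds and column totals along sequences of moves.

RowsWithin : ℕ → Diagram → Set
RowsWithin N D = ∀ s c → mem D s c ≡ true → 1 ≤ s × s ≤ N

falls-rowsWithin : ∀ {N D r r′ c E} → Falls D r r′ c E → RowsWithin N D → RowsWithin N E
falls-rowsWithin {N} {D} {r} {r′} {c} F W s a p with s ≟ r′
... | yes refl = Falls.positive F , ≤-trans (<⇒≤ (Falls.lower F)) (proj₂ (W r c (Falls.source F)))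
... | no s≢r′ with a ≟ c
...   | no a≢c = W s a (trans (sym (Falls.columns F s a a≢c)) p)
...   | yes refl with s ≟ r
...     | yes refl = ⊥-elim (true≢false p (Falls.vacated F))
...     | no s≢r = W s a (trans (sym (Falls.others F s s≢r s≢r′)) p)

⇝-rowsWithin : ∀ {N D E} → D ⇝ E → RowsWithin N D → RowsWithin N E
⇝-rowsWithin done W = W
⇝-rowsWithin {D = D} (step r p) W with kohnert r D | kohnert-view r D
... | _ | empty _ = ⇝-rowsWithin p W
... | _ | blocked _ _ _ = ⇝-rowsWithin p W
... | _ | moved _ _ _ F = ⇝-rowsWithin p (falls-rowsWithin F W)

-- The row bound puts every source at or below row `N`, so each move falls under `count-above`.
⇝-count : ∀ {N D E} → D ⇝ E → RowsWithin N D → ∀ c → count (column E c) N ≡ count (column D c) N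
⇝-count done W c = refl
⇝-count {N} {D} (step r p) W c with kohnert r D | kohnert-view r D
... | _ | empty _ = ⇝-count p W c
... | _ | blocked _ _ _ = ⇝-count p W c
... | E | moved r′ a R F = trans (⇝-count p (falls-rowsWithin F W) c) kept
  where
  kept : count (column E c) N ≡ count (column D c) N
  kept with a ≟ c
  ... | yes refl = count-above F (proj₂ (W r a (Falls.source F)))
  ... | no a≢c = column-count-cong (λ s → Falls.columns F s c (≢-sym a≢c)) N

-- Falling rows

EmptyFrom : ℕ → Diagram → ℕ → Set
EmptyFrom B D r = ∀ c → B ≤ c → mem D r c ≡ false

record Drops (S : ℕ → Bool) (r : ℕ) (D E : Diagram) : Set where
  field
    reach  : D ⇝ E
    upper  : ∀ c → mem E (suc r) c ≡ mem D (suc r) c ∧ not (S c)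
    lower  : ∀ c → mem E r c ≡ mem D r c ∨ (mem D (suc r) c ∧ S c)
    others : ∀ s c → s ≢ suc r → s ≢ r → mem E s c ≡ mem D s c

-- Induction on the column bound `B`: the cells leave row `suc r` from right to left, one move each.
-- A rightmost cell outside `S` ends the process, because `S` is closed to the right and so contains
-- no cell further left either.
drops : ∀ S r D B → 1 ≤ r → EmptyFrom B D (suc r) →
  (∀ {c c′} → c ≤ c′ → S c ≡ true → S c′ ≡ true) →
  (∀ c → mem D (suc r) c ≡ true → S c ≡ true → mem D r c ≡ false) →
  ∃[ E ] Drops S r D E
drops S r D zero 1≤r bnd suffix disjoint = D , record
  { reach = done
  ; upper = λ c → trans (bnd c z≤n) (cong (_∧ not (S c)) (sym (bnd c z≤n)))
  ; lower = λ c → sym (trans (cong (λ x → mem D r c ∨ (x ∧ S c)) (bnd c z≤n)) (∨-identityʳ _))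
  ; others = λ _ _ _ _ → refl }
drops S r D (suc B) 1≤r bnd suffix disjoint with mem D (suc r) B in eqB
... | false = drops S r D B 1≤r bnd′ suffix disjoint
  where
  bnd′ : EmptyFrom B D (suc r)
  bnd′ c B≤c with m≤n⇒m<n∨m≡n B≤c
  ... | inj₁ B<c = bnd c B<c
  ... | inj₂ refl = eqB
... | true with S B in eqS
...   | false = D , record
  { reach = done ; upper = upper ; lower = lower ; others = λ _ _ _ _ → refl }
  where
  stays : ∀ c → mem D (suc r) c ≡ true → S c ≡ false
  stays c p = ≢true⇒false λ q → true≢false (suffix (≮⇒≥ λ B<c → true≢false p (bnd c B<c)) q) eqS
  upper : ∀ c → mem D (suc r) c ≡ mem D (suc r) c ∧ not (S c)
  upper c with mem D (suc r) c in eq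
  ... | false = refl
  ... | true = cong not (sym (stays c eq))
  lower : ∀ c → mem D r c ≡ mem D r c ∨ (mem D (suc r) c ∧ S c)
  lower c with mem D (suc r) c in eq
  ... | false = sym (∨-identityʳ _)
  ... | true = sym (trans (cong (mem D r c ∨_) (stays c eq)) (∨-identityʳ _))
...   | true = proj₁ rest , record
  { reach = step (suc r) (Drops.reach R) ; upper = upper ; lower = lower ; others = others }
  where
  D′ = kohnert (suc r) D
  F : Falls D (suc r) r B D′
  -- Column `B` is the last occupied one of the row, and `disjoint` makes the position below it
  -- vacant.
  F = kohnert-down 1≤r (eqB , λ c B<c → bnd c B<c) (disjoint B eqB eqS)
  bnd′ : EmptyFrom B D′ (suc r)
  bnd′ c B≤c with m≤n⇒m<n∨m≡n B≤c
  ... | inj₁ B<c = trans (Falls.columns F (suc r) c (≢-sym (<⇒≢ B<c))) (bnd c B<c)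
  ... | inj₂ refl = Falls.vacated F
  disjoint′ : ∀ c → mem D′ (suc r) c ≡ true → S c ≡ true → mem D′ r c ≡ false
  disjoint′ c p q with c ≟ B
  ... | yes refl = ⊥-elim (true≢false p (Falls.vacated F))
  ... | no c≢B = trans (Falls.columns F r c c≢B)
    (disjoint c (trans (sym (Falls.columns F (suc r) c c≢B)) p) q)
  rest = drops S r D′ B 1≤r bnd′ suffix disjoint′
  E = proj₁ rest
  R = proj₂ rest
  upper : ∀ c → mem E (suc r) c ≡ mem D (suc r) c ∧ not (S c)
  upper c with c ≟ B
  ... | yes refl rewrite Drops.upper R B | Falls.vacated F | eqB | eqS = refl
  ... | no c≢B rewrite Drops.upper R c | Falls.columns F (suc r) c c≢B = refl
  lower : ∀ c → mem E r c ≡ mem D r c ∨ (mem D (suc r) c ∧ S c)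
  lower c with c ≟ B
  ... | yes refl rewrite Drops.lower R B | Falls.target F | eqB | eqS | disjoint B eqB eqS = refl
  ... | no c≢B rewrite Drops.lower R c | Falls.columns F (suc r) c c≢B | Falls.columns F r c c≢B = refl
  others : ∀ s c → s ≢ suc r → s ≢ r → mem E s c ≡ mem D s c
  others s c s≢sr s≢r with c ≟ B
  ... | yes refl = trans (Drops.others R s B s≢sr s≢r) (Falls.others F s s≢sr s≢r)
  ... | no c≢B = trans (Drops.others R s c s≢sr s≢r) (Falls.columns F s c c≢B)

record FallsBy (r d : ℕ) (D E : Diagram) : Set where
  field
    reach   : D ⇝ E
    landed  : ∀ c → mem E r c ≡ mem D (r + d) c
    cleared : ∀ s c → r < s → s ≤ r + d → mem E s c ≡ false
    others  : ∀ s c → s < r ⊎ r + d < s → mem E s c ≡ mem D s c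

-- The row descends one level at a time by `drops` with all columns selected; by `void` every row it
-- enters is empty.
fallsBy : ∀ r d D B → 1 ≤ r → EmptyFrom B D (r + d) →
  (∀ s c → r ≤ s → s < r + d → mem D s c ≡ false) → ∃[ E ] FallsBy r d D E
fallsBy r zero D B 1≤r bnd void = D , record
  { reach = done
  ; landed = λ c → cong (λ x → mem D x c) (sym (+-identityʳ r))
  ; cleared = λ s c r<s s≤ → ⊥-elim (<⇒≱ r<s (subst (s ≤_) (+-identityʳ r) s≤))
  ; others = λ _ _ _ → refl }
fallsBy r (suc d) D B 1≤r bnd void = E , record
  { reach = ⇝-trans (Drops.reach R₁) (FallsBy.reach R₂)
  ; landed = λ c → trans (FallsBy.landed R₂ c) (trans (moved-down c) (cong (λ x → mem D x c) (sym eq)))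
  ; cleared = λ s c r<s s≤ → cleared s c r<s (subst (s ≤_) eq s≤)
  ; others = λ { s c (inj₁ s<r) → others s c (inj₁ s<r)
               ; s c (inj₂ gt) → others s c (inj₂ (subst (_< s) eq gt)) } }
  where
  eq = +-suc r d
  start : EmptyFrom B D (suc (r + d))
  start = subst (EmptyFrom B D) eq bnd
  1≤r+d = ≤-trans 1≤r (m≤m+n r d)
  above : ∀ s c → r ≤ s → s < suc (r + d) → mem D s c ≡ false
  above s c r≤s s< = void s c r≤s (subst (s <_) (sym eq) s<)
  first = drops (λ _ → true) (r + d) D B 1≤r+d start (λ _ p → p)
    (λ c _ _ → above (r + d) c (m≤m+n r d) ≤-refl)
  D′ = proj₁ first
  R₁ = proj₂ first
  moved-down : ∀ c → mem D′ (r + d) c ≡ mem D (suc (r + d)) c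
  moved-down c rewrite Drops.lower R₁ c | above (r + d) c (m≤m+n r d) ≤-refl = ∧-identityʳ _
  vacated : ∀ c → mem D′ (suc (r + d)) c ≡ false
  vacated c = trans (Drops.upper R₁ c) (∧-zeroʳ _)
  second = fallsBy r d D′ B 1≤r (λ c p → trans (moved-down c) (start c p))
    (λ s c r≤s s< → trans (Drops.others R₁ s c (<⇒≢ (m≤n⇒m≤1+n s<)) (<⇒≢ s<))
                          (above s c r≤s (m≤n⇒m≤1+n s<)))
  E = proj₁ second
  R₂ = proj₂ second
  cleared : ∀ s c → r < s → s ≤ suc (r + d) → mem E s c ≡ false
  cleared s c r<s s≤ with m≤n⇒m<n∨m≡n s≤
  ... | inj₁ (s≤s s≤r+d) = FallsBy.cleared R₂ s c r<s s≤r+d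
  ... | inj₂ refl = trans (FallsBy.others R₂ s c (inj₂ ≤-refl)) (vacated c)
  others : ∀ s c → s < r ⊎ suc (r + d) < s → mem E s c ≡ mem D s c
  others s c (inj₁ s<r) = trans (FallsBy.others R₂ s c (inj₁ s<r))
    (Drops.others R₁ s c (<⇒≢ (m≤n⇒m≤1+n s<r+d)) (<⇒≢ s<r+d))
    where s<r+d = <-≤-trans s<r (m≤m+n r d)
  others s c (inj₂ gt) = trans (FallsBy.others R₂ s c (inj₂ (<-trans (n<1+n _) gt)))
    (Drops.others R₁ s c (≢-sym (<⇒≢ gt)) (≢-sym (<⇒≢ (<-trans (n<1+n _) gt))))

-- Reaching the minimal diagrams

≤ᵇ⁺ : ∀ {a b} → a ≤ b → (a ≤ᵇ b) ≡ true
≤ᵇ⁺ {a} {b} = dec-true (a ≤? b)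

≤ᵇ⁻ : ∀ {a b} → (a ≤ᵇ b) ≡ true → a ≤ b
≤ᵇ⁻ {a} {b} p = ≤ᵇ⇒≤ a b (subst T (sym p) _)

≰ᵇ⁺ : ∀ {a b} → b < a → (a ≤ᵇ b) ≡ false
≰ᵇ⁺ {a} {b} b<a = dec-false (a ≤? b) (<⇒≱ b<a)

≡ᵇ⁺ : ∀ {a b} → a ≡ b → (a ≡ᵇ b) ≡ true
≡ᵇ⁺ {a} {b} = dec-true (a ≟ b)

≢ᵇ⁺ : ∀ {a b} → a ≢ b → (a ≡ᵇ b) ≡ false
≢ᵇ⁺ {a} {b} = dec-false (a ≟ b)

-- Used to complete row `suc i`: short cells with hole at most `i` are already there, those with
-- hole at least `2+ i` drop in, and exactly the hole at `suc i` stays open.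
≤ᵇ∨≥ᵇ : ∀ h i → (h ≤ᵇ i) ∨ (2+ i ≤ᵇ h) ≡ not (h ≡ᵇ suc i)
≤ᵇ∨≥ᵇ h i with <-cmp h (suc i)
... | tri< lt ne _ rewrite ≤ᵇ⁺ (s≤s⁻¹ lt) | ≢ᵇ⁺ ne = refl
... | tri≈ _ refl _ rewrite ≰ᵇ⁺ {suc i} {i} ≤-refl | ≡ᵇ⁺ {i} refl = refl
... | tri> _ ne gt rewrite ≰ᵇ⁺ (<-trans (n<1+n i) gt) | ≤ᵇ⁺ gt | ≢ᵇ⁺ ne = refl

not-≤ᵇ : ∀ h i → not (suc i ≤ᵇ h) ≡ (h ≤ᵇ i)
not-≤ᵇ h i with h ≤? i
... | yes p rewrite ≰ᵇ⁺ (s≤s p) = sym (≤ᵇ⁺ p)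
... | no p rewrite ≤ᵇ⁺ (≰⇒> p) = sym (≰ᵇ⁺ (≰⇒> p))

∧-true : ∀ {a b} → a ∧ b ≡ true → a ≡ true × b ≡ true
∧-true {true} p = refl , p

-- `alternating false` tests for odd numbers, `alternating true` for even ones.
alternating : Bool → ℕ → Bool
alternating b zero    = b
alternating b (suc k) = not (alternating b k)

alternating-not : ∀ b k → alternating (not b) k ≡ not (alternating b k)
alternating-not b zero = refl
alternating-not b (suc k) = cong not (alternating-not b k)

alternating-double : ∀ b i → alternating b (i + i) ≡ b
alternating-double b zero = refl
alternating-double b (suc i) rewrite +-suc i i | alternating-double b i = not-involutive b

-- Opaque so that `inside n (suc k)` does not reduce and remains one term for `rewrite`.
opaque
  inside : ℕ → ℕ → Bool
  inside n k = (1 ≤ᵇ k) ∧ (k ≤ᵇ n)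

  inside⁺ : ∀ {n k} → 1 ≤ k → k ≤ n → inside n k ≡ true
  inside⁺ p q rewrite ≤ᵇ⁺ p | ≤ᵇ⁺ q = refl

  inside⁻ : ∀ {n k} → inside n k ≡ true → 1 ≤ k × k ≤ n
  inside⁻ p with q , r ← ∧-true p = ≤ᵇ⁻ q , ≤ᵇ⁻ r

  inside-0 : ∀ n → inside n 0 ≡ false
  inside-0 n = refl

  outside⁺ : ∀ {n k} → n < k → inside n k ≡ false
  outside⁺ {n} {k} p rewrite ≰ᵇ⁺ p = ∧-zeroʳ (1 ≤ᵇ k)

⌈n/2⌉≤1+⌊n/2⌋ : ∀ n → ⌈ n /2⌉ ≤ suc ⌊ n /2⌋
⌈n/2⌉≤1+⌊n/2⌋ zero = z≤n
⌈n/2⌉≤1+⌊n/2⌋ (suc zero) = ≤-refl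
⌈n/2⌉≤1+⌊n/2⌋ (2+ n) = s≤s (⌈n/2⌉≤1+⌊n/2⌋ n)

-- `b = false` is the first checkered diagram and `b = true` the second. There are `M` odd and `m`
-- even rows among the first `n`.
module Checkered (b : Bool) (n : ℕ) where

  m M : ℕ
  m = ⌊ n /2⌋
  M = ⌈ n /2⌉

  m+M≡n : m + M ≡ n
  m+M≡n = ⌊n/2⌋+⌈n/2⌉≡n n

  m≤M : m ≤ M
  m≤M = ⌊n/2⌋≤⌈n/2⌉ n

  M≤1+m : M ≤ suc m
  M≤1+m = ⌈n/2⌉≤1+⌊n/2⌋ n

  -- The columns whose initial cells lie in the odd rows; they hold M cells, the others m.
  long : ℕ → Bool
  long = alternating b

  checkered : ℕ → ℕ → Bool
  checkered s c = inside n s ∧ (inside n c ∧ not (alternating false s xor long c))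

  checkered-odd : ∀ i c → checkered (suc (i + i)) c ≡ inside n (suc (i + i)) ∧ (inside n c ∧ long c)
  checkered-odd i c rewrite alternating-double false i | not-involutive (long c) = refl

  checkered-even : ∀ i c → checkered (2+ (i + i)) c ≡ inside n (2+ (i + i)) ∧ (inside n c ∧ not (long c))
  checkered-even i c rewrite alternating-double false i = refl

  -- Both sides say that `n` is odd: cancel `m` in `m + suc m ≤ m + M`.
  inside-1+2m : inside n (suc (m + m)) ≡ (suc m ≤ᵇ M)
  inside-1+2m = Bool-ext {inside n (suc (m + m))}
    (λ p → ≤ᵇ⁺ (+-cancelˡ-≤ m (suc m) M (subst₂ _≤_ (sym (+-suc m m)) (sym m+M≡n) (proj₂ (inside⁻ {n} {suc (m + m)} p)))))
    (λ p → inside⁺ {n} (s≤s z≤n) (subst₂ _≤_ (+-suc m m) m+M≡n (+-monoʳ-≤ m (≤ᵇ⁻ {suc m} p))))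

  checkered-row : ∀ {s} c → n < s → checkered s c ≡ false
  checkered-row c p rewrite outside⁺ p = refl

  checkered-column : ∀ s {c} → n < c → checkered s c ≡ false
  checkered-column s p rewrite outside⁺ p = ∧-zeroʳ (inside n s)

  module Profile (h : ℕ → ℕ) where

    -- A hole at `suc m` leaves a short column of height `m`. With all holes there and `n` even,
    -- this is the rectangle.
    target : ℕ → ℕ → Bool
    target s c = inside n c ∧ ((1 ≤ᵇ s) ∧ (if long c then s ≤ᵇ M else ((s ≤ᵇ suc m) ∧ not (h c ≡ᵇ s))))

    -- The first i rows are final, row 1 + i holds the long cells and those short cells
    -- that already lie above their hole, and rows above 1 + 2 i are untouched.
    record Stage (i : ℕ) (D : Diagram) : Set where
      field
        bottom  : ∀ c → mem D 0 c ≡ false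
        final   : ∀ s c → 1 ≤ s → s ≤ i → mem D s c ≡ inside n c ∧ (long c ∨ not (h c ≡ᵇ s))
        top     : ∀ c → mem D (suc i) c ≡
                  checkered (suc (i + i)) c ∨ (inside n c ∧ (not (long c) ∧ (h c ≤ᵇ i)))
        cleared : ∀ s c → suc i < s → s ≤ suc (i + i) → mem D s c ≡ false
        rest    : ∀ s c → suc (i + i) < s → mem D s c ≡ checkered s c

    stage-0 : ∀ {D} → (∀ c → 1 ≤ h c) → (∀ s c → mem D s c ≡ checkered s c) → Stage 0 D
    stage-0 pos e = record
      { bottom  = λ c → trans (e 0 c) (cong (_∧ (inside n c ∧ not (long c))) (inside-0 n))
      ; final   = λ { (suc _) c _ () }
      ; top     = λ c → trans (e 1 c) (sym (top c))
      ; cleared = λ s c p q → ⊥-elim (<⇒≱ p q)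
      ; rest    = λ s c _ → e s c }
      where
      top : ∀ c → checkered 1 c ∨ (inside n c ∧ (not (long c) ∧ (h c ≤ᵇ 0))) ≡ checkered 1 c
      top c rewrite ≰ᵇ⁺ (pos c) | ∧-zeroʳ (not (long c)) | ∧-zeroʳ (inside n c) = ∨-identityʳ _

    -- Four steps: row `2+ (i + i)` falls to row `2+ i`, its cells in `S` drop to row `suc i`, row
    -- `3 + (i + i)` falls to row `3 + i` and then drops once more. The last level is separate
    -- because row `2+ i` may still hold short cells. Monotone holes make `S` closed to the right.
    stage-suc : ∀ {i D} → (∀ {c c′} → c ≤ c′ → h c ≤ h c′) → 2+ (i + i) ≤ n → Stage i D →
      ∃[ E ] (D ⇝ E × Stage (suc i) E)
    stage-suc {i} {D} h-mono 2+2i≤n st = D₄ ,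
      ⇝-trans (FallsBy.reach F₁) (⇝-trans (Drops.reach R₂) (⇝-trans (FallsBy.reach F₃) (Drops.reach R₄))) ,
      record { bottom = bottom′ ; final = final′ ; top = top′ ; cleared = cleared′ ; rest = rest′ }
      where
      open Stage st
      -- A short cell with hole at `suc i` stays up and so creates the hole; one with a lower hole
      -- stays on top of a cell that is already above the hole.
      S : ℕ → Bool
      S c = 2+ i ≤ᵇ h c

      abstract
        fall₁ : ∃[ E ] FallsBy (2+ i) i D E
        fall₁ = fallsBy (2+ i) i D (suc n) (s≤s z≤n)
          (λ c p → trans (rest _ c ≤-refl) (checkered-column (2+ (i + i)) p))
          (λ s c p q → cleared s c p (s≤s⁻¹ q))
      D₁ = proj₁ fall₁
      F₁ = proj₂ fall₁

      inside-odd : inside n (suc (i + i)) ≡ true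
      inside-odd = inside⁺ {n} (s≤s z≤n) (<⇒≤ 2+2i≤n)

      D-top : ∀ c → mem D (suc i) c ≡ (inside n c ∧ long c) ∨ (inside n c ∧ (not (long c) ∧ (h c ≤ᵇ i)))
      D-top c = trans (top c) (cong (_∨ (inside n c ∧ (not (long c) ∧ (h c ≤ᵇ i))))
        (trans (checkered-odd i c) (cong (_∧ (inside n c ∧ long c)) inside-odd)))

      D₁-short : ∀ c → mem D₁ (2+ i) c ≡ inside n c ∧ not (long c)
      D₁-short c = trans (FallsBy.landed F₁ c) (trans (rest _ c ≤-refl)
        (trans (checkered-even i c) (cong (_∧ (inside n c ∧ not (long c))) (inside⁺ {n} (s≤s z≤n) 2+2i≤n))))

      D₁-top : ∀ c → mem D₁ (suc i) c ≡ mem D (suc i) c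
      D₁-top c = FallsBy.others F₁ (suc i) c (inj₁ ≤-refl)

      -- The short cells of row `suc i` have holes at most `i`, which excludes columns of `S`.
      disjoint₂ : ∀ c → mem D₁ (2+ i) c ≡ true → S c ≡ true → mem D₁ (suc i) c ≡ false
      disjoint₂ c p q = trans (D₁-top c) (trans (D-top c) (away (trans (sym (D₁-short c)) p)))
        where
        away : inside n c ∧ not (long c) ≡ true →
          (inside n c ∧ long c) ∨ (inside n c ∧ (not (long c) ∧ (h c ≤ᵇ i))) ≡ false
        away eq with true ← inside n c with false ← long c = ≰ᵇ⁺ {h c} {i} (<⇒≤ (≤ᵇ⁻ {2+ i} {h c} q))

      abstract
        drop₂ : ∃[ E ] Drops S (suc i) D₁ E
        drop₂ = drops S (suc i) D₁ (suc n) (s≤s z≤n)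
          (λ c p → trans (D₁-short c) (cong (_∧ not (long c)) (outside⁺ {n} p)))
          (λ c≤c′ p → ≤ᵇ⁺ {2+ i} {h _} (≤-trans (≤ᵇ⁻ {2+ i} {h _} p) (h-mono c≤c′)))
          disjoint₂
      D₂ = proj₁ drop₂
      R₂ = proj₂ drop₂

      D₂-others : ∀ s c → 2+ (i + i) < s → mem D₂ s c ≡ checkered s c
      D₂-others s c p = trans (Drops.others R₂ s c (≢-sym (<⇒≢ 2+i<s)) (≢-sym (<⇒≢ (<⇒≤ 2+i<s))))
        (trans (FallsBy.others F₁ s c (inj₂ p)) (rest s c (<⇒≤ p)))
        where 2+i<s = ≤-<-trans (s≤s (s≤s (m≤m+n i i))) p

      D₂-cleared : ∀ s c → 2+ i < s → s ≤ 2+ (i + i) → mem D₂ s c ≡ false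
      D₂-cleared s c p q = trans (Drops.others R₂ s c (≢-sym (<⇒≢ p)) (≢-sym (<⇒≢ (<⇒≤ p))))
        (FallsBy.cleared F₁ s c p q)

      abstract
        fall₃ : ∃[ E ] FallsBy (3 + i) i D₂ E
        fall₃ = fallsBy (3 + i) i D₂ (suc n) (s≤s z≤n)
          (λ c p → trans (D₂-others _ c ≤-refl) (checkered-column (3 + (i + i)) p))
          (λ s c p q → D₂-cleared s c p (s≤s⁻¹ q))
      D₃ = proj₁ fall₃
      F₃ = proj₂ fall₃

      -- In the last round for even `n` the row `3 + (i + i)` lies outside the diagram, so the
      -- factor for the row is kept.
      next : ℕ → Bool
      next c = inside n (3 + (i + i)) ∧ (inside n c ∧ long c)

      checkered-next : ∀ c → checkered (suc (suc i + suc i)) c ≡ next c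
      checkered-next c = trans (checkered-odd (suc i) c)
        (cong (λ k → inside n (2+ k) ∧ (inside n c ∧ long c)) (+-suc i i))

      D₃-long : ∀ c → mem D₃ (3 + i) c ≡ next c
      D₃-long c = trans (FallsBy.landed F₃ c) (trans (D₂-others _ c ≤-refl)
        (trans (cong (λ k → checkered (2+ k) c) (sym (+-suc i i))) (checkered-next c)))

      D₃-short : ∀ c → mem D₃ (2+ i) c ≡ (inside n c ∧ not (long c)) ∧ not (S c)
      D₃-short c = trans (FallsBy.others F₃ (2+ i) c (inj₁ ≤-refl))
        (trans (Drops.upper R₂ c) (cong (_∧ not (S c)) (D₁-short c)))

      disjoint₄ : ∀ c → mem D₃ (3 + i) c ≡ true → true ≡ true → mem D₃ (2+ i) c ≡ false
      disjoint₄ c p _ = trans (D₃-short c)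
        (away (proj₂ (∧-true {inside n (3 + (i + i))} (trans (sym (D₃-long c)) p))))
        where
        away : inside n c ∧ long c ≡ true → (inside n c ∧ not (long c)) ∧ not (S c) ≡ false
        away eq with true ← inside n c with true ← long c = refl

      abstract
        drop₄ : ∃[ E ] Drops (λ _ → true) (2+ i) D₃ E
        drop₄ = drops (λ _ → true) (2+ i) D₃ (suc n) (s≤s z≤n)
          (λ c p → trans (D₃-long c) (trans (cong (λ x → inside n (3 + (i + i)) ∧ (x ∧ long c)) (outside⁺ {n} p))
                                            (∧-zeroʳ _)))
          (λ _ p → p) disjoint₄
      D₄ = proj₁ drop₄
      R₄ = proj₂ drop₄

      below : ∀ s c → s ≤ i → mem D₄ s c ≡ mem D s c
      below s c s≤i = begin
        mem D₄ s c ≡⟨ Drops.others R₄ s c (<⇒≢ (m≤n⇒m≤1+n s<2+i)) (<⇒≢ s<2+i) ⟩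
        mem D₃ s c ≡⟨ FallsBy.others F₃ s c (inj₁ (m≤n⇒m≤1+n s<2+i)) ⟩
        mem D₂ s c ≡⟨ Drops.others R₂ s c (<⇒≢ s<2+i) (<⇒≢ s<1+i) ⟩
        mem D₁ s c ≡⟨ FallsBy.others F₁ s c (inj₁ s<2+i) ⟩
        mem D s c  ∎
        where
        open ≡-Reasoning
        s<1+i = s≤s s≤i
        s<2+i = m≤n⇒m≤1+n s<1+i

      bottom′ : ∀ c → mem D₄ 0 c ≡ false
      bottom′ c = trans (below 0 c z≤n) (bottom c)

      finished : ∀ c → ((inside n c ∧ long c) ∨ (inside n c ∧ (not (long c) ∧ (h c ≤ᵇ i)))) ∨
        ((inside n c ∧ not (long c)) ∧ S c) ≡ inside n c ∧ (long c ∨ not (h c ≡ᵇ suc i))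
      finished c with inside n c | long c
      ... | false | _     = refl
      ... | true  | true  = refl
      ... | true  | false = ≤ᵇ∨≥ᵇ (h c) i

      final′ : ∀ s c → 1 ≤ s → s ≤ suc i → mem D₄ s c ≡ inside n c ∧ (long c ∨ not (h c ≡ᵇ s))
      final′ s c 1≤s s≤ with m≤n⇒m<n∨m≡n s≤
      ... | inj₁ (s≤s s≤i) = trans (below s c s≤i) (final s c 1≤s s≤i)
      ... | inj₂ refl = begin
        mem D₄ (suc i) c ≡⟨ Drops.others R₄ (suc i) c (λ ()) (<⇒≢ ≤-refl) ⟩
        mem D₃ (suc i) c ≡⟨ FallsBy.others F₃ (suc i) c (inj₁ (m≤n⇒m≤1+n ≤-refl)) ⟩
        mem D₂ (suc i) c ≡⟨ Drops.lower R₂ c ⟩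
        mem D₁ (suc i) c ∨ (mem D₁ (2+ i) c ∧ S c)
          ≡⟨ cong₂ (λ x y → x ∨ (y ∧ S c)) (trans (D₁-top c) (D-top c)) (D₁-short c) ⟩
        _ ≡⟨ finished c ⟩
        _ ∎
        where open ≡-Reasoning

      top′ : ∀ c → mem D₄ (2+ i) c ≡
        checkered (suc (suc i + suc i)) c ∨ (inside n c ∧ (not (long c) ∧ (h c ≤ᵇ suc i)))
      top′ c = begin
        mem D₄ (2+ i) c ≡⟨ Drops.lower R₄ c ⟩
        mem D₃ (2+ i) c ∨ (mem D₃ (3 + i) c ∧ true)
          ≡⟨ cong₂ (λ x y → x ∨ (y ∧ true)) (D₃-short c) (D₃-long c) ⟩
        ((inside n c ∧ not (long c)) ∧ not (S c)) ∨ (next c ∧ true)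
          ≡⟨ rearrange (inside n c) (long c) (not (S c)) (next c) ⟩
        next c ∨ (inside n c ∧ (not (long c) ∧ not (S c)))
          ≡⟨ cong₂ (λ x y → x ∨ (inside n c ∧ (not (long c) ∧ y))) (sym (checkered-next c)) (not-≤ᵇ (h c) (suc i)) ⟩
        _ ∎
        where
        open ≡-Reasoning
        rearrange : ∀ I L N X → ((I ∧ not L) ∧ N) ∨ (X ∧ true) ≡ X ∨ (I ∧ (not L ∧ N))
        rearrange false L N X rewrite ∧-identityʳ X = sym (∨-identityʳ X)
        rearrange true true N X rewrite ∧-identityʳ X = sym (∨-identityʳ X)
        rearrange true false true true = refl
        rearrange true false true false = refl
        rearrange true false false true = refl
        rearrange true false false false = refl

      cleared′ : ∀ s c → 2+ i < s → s ≤ suc (suc i + suc i) → mem D₄ s c ≡ false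
      cleared′ s c p q with m≤n⇒m<n∨m≡n p
      ... | inj₂ refl = trans (Drops.upper R₄ c) (∧-zeroʳ _)
      ... | inj₁ p′ = trans (Drops.others R₄ s c (≢-sym (<⇒≢ p′)) (≢-sym (<⇒≢ p)))
        (FallsBy.cleared F₃ s c p′ (subst (s ≤_) (cong 2+ (+-suc i i)) q))

      rest′ : ∀ s c → suc (suc i + suc i) < s → mem D₄ s c ≡ checkered s c
      rest′ s c p = trans (Drops.others R₄ s c (≢-sym (<⇒≢ 3+i<s)) (≢-sym (<⇒≢ (<⇒≤ 3+i<s))))
        (trans (FallsBy.others F₃ s c (inj₂ 3+2i<s)) (D₂-others s c (<⇒≤ 3+2i<s)))
        where
        3+2i<s : 3 + (i + i) < s
        3+2i<s = subst (_< s) (cong 2+ (+-suc i i)) p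
        3+i<s : 3 + i < s
        3+i<s = ≤-<-trans (+-monoʳ-≤ 3 (m≤m+n i i)) 3+2i<s

    stages : ∀ {D} → (∀ c → 1 ≤ h c) → (∀ {c c′} → c ≤ c′ → h c ≤ h c′) →
      (∀ s c → mem D s c ≡ checkered s c) → ∀ i → i ≤ m → ∃[ E ] (D ⇝ E × Stage i E)
    stages {D} pos mono e zero _ = D , done , stage-0 pos e
    stages pos mono e (suc i) i<m
      with E , D⇝E , st ← stages pos mono e i (<⇒≤ i<m)
      with F , E⇝F , st′ ← stage-suc mono
             -- Since `i < m ≤ M`, twice `suc i` is at most `m + M`, which is `n`.
             (subst₂ _≤_ (cong suc (+-suc i i)) m+M≡n (+-mono-≤ i<m (≤-trans i<m m≤M))) st
      = F , ⇝-trans D⇝E E⇝F , st′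

    -- Row `suc s` is final if `s < m`. For `s = m` it is the top row, made of the original row
    -- `1 + 2m`, present only for odd `n`, and of the short cells above their holes. Everything
    -- higher is cleared or outside the diagram.
    stage-m : ∀ {D} → (∀ c → h c ≤ suc m) → Stage m D → ∀ s c → mem D s c ≡ target s c
    stage-m {D} bounded st zero c = trans (Stage.bottom st c) (sym (∧-zeroʳ (inside n c)))
    stage-m {D} bounded st (suc s) c with <-cmp s m
    ... | tri< s<m _ _ rewrite Stage.final st (suc s) c (s≤s z≤n) s<m
                             | ≤ᵇ⁺ (≤-trans s<m m≤M) | ≤ᵇ⁺ (m≤n⇒m≤1+n s<m) with long c
    ...   | true = refl
    ...   | false = refl
    stage-m {D} bounded st (suc s) c | tri≈ _ refl _
      rewrite Stage.top st c | checkered-odd m c | ≤ᵇ⁺ {suc m} ≤-refl | inside-1+2m = go (inside n c) (long c)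
      where
      -- The alternative `2+ m ≤ h c` is excluded by `bounded`.
      low : (h c ≤ᵇ m) ≡ not (h c ≡ᵇ suc m)
      low = trans (sym (trans (cong ((h c ≤ᵇ m) ∨_) (≰ᵇ⁺ (s≤s (bounded c)))) (∨-identityʳ _))) (≤ᵇ∨≥ᵇ (h c) m)
      go : ∀ I L → ((suc m ≤ᵇ M) ∧ (I ∧ L)) ∨ (I ∧ (not L ∧ (h c ≤ᵇ m))) ≡
                   I ∧ (if L then suc m ≤ᵇ M else not (h c ≡ᵇ suc m))
      go false L = trans (∨-identityʳ _) (∧-zeroʳ _)
      go true true = trans (∨-identityʳ _) (∧-identityʳ _)
      go true false rewrite ∧-zeroʳ (suc m ≤ᵇ M) = low
    stage-m {D} bounded st (suc s) c | tri> _ _ m<s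
      rewrite ≰ᵇ⁺ {suc s} {M} (≤-<-trans M≤1+m (s≤s m<s)) | ≰ᵇ⁺ {suc s} {suc m} (s≤s m<s) = trans void (sym (go (long c)))
      where
      void : mem D (suc s) c ≡ false
      void with suc s ≤? suc (m + m)
      ... | yes p = Stage.cleared st (suc s) c (s≤s m<s) p
      ... | no p = trans (Stage.rest st (suc s) c (≰⇒> p)) (checkered-row c
        (≤-<-trans (subst₂ _≤_ m+M≡n (+-suc m m) (+-monoʳ-≤ m M≤1+m)) (≰⇒> p)))
      go : ∀ L → inside n c ∧ (if L then false else false) ≡ false
      go true = ∧-zeroʳ _
      go false = ∧-zeroʳ _

    -- M ≡ suc m says that n is odd; for even n no hole may lie among the first m rows.
    record Admissible : Set where
      field
        positive : ∀ c → 1 ≤ h c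
        bounded  : ∀ c → h c ≤ suc m
        monotone : ∀ {c c′} → c ≤ c′ → h c ≤ h c′
        last     : h n ≡ suc m
        low      : ∀ c → h c ≤ m → M ≡ suc m

    final-diagram : Diagram
    final-diagram = filter (λ x → target (proj₁ x) (proj₂ x) ≟ᵇ true)
      (cartesianProduct (upTo (2+ m)) (upTo (suc n)))

    target⁻ : ∀ {s c} → target s c ≡ true → inside n c ≡ true × 1 ≤ s ×
      (if long c then s ≤ᵇ M else ((s ≤ᵇ suc m) ∧ not (h c ≡ᵇ s))) ≡ true
    target⁻ {s} {c} p with i , q ← ∧-true {inside n c} p with j , r ← ∧-true {1 ≤ᵇ s} q = i , ≤ᵇ⁻ j , r

    target-row : ∀ {s c} → target s c ≡ true → s ≤ suc m
    target-row {s} {c} p with long c | proj₂ (proj₂ (target⁻ {s} {c} p))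
    ... | true | q = ≤-trans (≤ᵇ⁻ {s} q) M≤1+m
    ... | false | q = ≤ᵇ⁻ {s} (proj₁ (∧-true q))

    mem-final-diagram : ∀ s c → mem final-diagram s c ≡ target s c
    mem-final-diagram s c = Bool-ext
      (λ p → proj₂ (∈-filter⁻ (λ x → target (proj₁ x) (proj₂ x) ≟ᵇ true)
               {xs = cartesianProduct (upTo (2+ m)) (upTo (suc n))} (mem⁻ {final-diagram} p)))
      (λ p → mem⁺ (∈-filter⁺ (λ x → target (proj₁ x) (proj₂ x) ≟ᵇ true)
        (∈-cartesianProduct⁺ (∈-upTo⁺ (s≤s (target-row {s} {c} p)))
                             (∈-upTo⁺ (s≤s (proj₂ (inside⁻ {n} (proj₁ (target⁻ {s} {c} p)))))))
        p))

    -- Below a cell of a long column all is full. A short cell in row `r` with its hole underneath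
    -- has hole at most `m`, so its column is not `n` and `n` is odd. The next column is then long
    -- with height `suc m`, reaches row `r`, and the short cell was not rightmost.
    target-stable : Admissible → ∀ {D} → (∀ s c → mem D s c ≡ target s c) → Stable D
    target-stable adm {D} e {r} {c} (here′ , right) s 1≤s s<r
      with inside-c , 1≤r , q ← target⁻ {r} {c} (trans (sym (e r c)) here′)
      with long c in eqL
    ... | true = trans (e s c) filled
      where
      filled : target s c ≡ true
      filled rewrite inside-c | ≤ᵇ⁺ 1≤s | eqL = ≤ᵇ⁺ (≤-trans (<⇒≤ s<r) (≤ᵇ⁻ {r} q))
    ... | false with h c ≟ s
    ...   | no h≢s = trans (e s c) filled
      where
      filled : target s c ≡ true
      filled rewrite inside-c | ≤ᵇ⁺ 1≤s | eqL | ≢ᵇ⁺ h≢s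
        | ≤ᵇ⁺ (≤-trans (<⇒≤ s<r) (≤ᵇ⁻ {r} (proj₁ (∧-true q)))) = refl
    ...   | yes refl = ⊥-elim (true≢false (trans (e r (suc c)) blocking) (right (suc c) ≤-refl))
      where
      open Admissible adm
      r≤1+m : r ≤ suc m
      r≤1+m = ≤ᵇ⁻ {r} (proj₁ (∧-true q))
      hole-low : h c ≤ m
      hole-low = s≤s⁻¹ (≤-trans s<r r≤1+m)
      c<n : c < n
      c<n = ≤∧≢⇒< (proj₂ (inside⁻ {n} inside-c)) λ { refl → <⇒≱ (≤-reflexive (sym last)) hole-low }
      blocking : target r (suc c) ≡ true
      blocking rewrite inside⁺ {n} {suc c} (s≤s z≤n) c<n | ≤ᵇ⁺ 1≤r | eqL =
        ≤ᵇ⁺ (≤-trans r≤1+m (≤-reflexive (sym (low c hole-low))))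

    final-diagram-IsMin : Admissible → ∀ {D₀} → (∀ s c → mem D₀ s c ≡ checkered s c) → IsMin D₀ final-diagram
    final-diagram-IsMin adm {D₀} e
      with E , D₀⇝E , st ← stages (Admissible.positive adm) (Admissible.monotone adm) e m ≤-refl
      = Stable⇒IsMin (E , D₀⇝E , mem⇒≈D λ s c →
          trans (stage-m (Admissible.bounded adm) st s c) (sym (mem-final-diagram s c)))
        (target-stable adm mem-final-diagram)

-- Weakly increasing lists

-- The index `lo` bounds the next entry from below. The upper bound is checked once, at the end of
-- the list.
data Increasing (hi : ℕ) : ℕ → List ℕ → Set where
  []  : ∀ {lo} → lo ≤ hi → Increasing hi lo []
  _∷_ : ∀ {lo x w} → lo ≤ x → Increasing hi x w → Increasing hi lo (x ∷ w)

increasing-lower : ∀ {hi lo lo′ w} → lo ≤ lo′ → Increasing hi lo′ w → Increasing hi lo w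
increasing-lower p ([] q)  = [] (≤-trans p q)
increasing-lower p (q ∷ i) = ≤-trans p q ∷ i

increasing-bounds : ∀ {hi lo w} → Increasing hi lo w → lo ≤ hi
increasing-bounds ([] p)  = p
increasing-bounds (p ∷ i) = ≤-trans p (increasing-bounds i)

increasing-applyUpTo : ∀ {hi lo} g k → lo ≤ hi → (∀ j → j < k → lo ≤ g j × g j ≤ hi) →
  (∀ {i j} → i < j → j < k → g i ≤ g j) → Increasing hi lo (applyUpTo g k)
increasing-applyUpTo g zero    lo≤hi _ _ = [] lo≤hi
increasing-applyUpTo g (suc k) _ bounds mono with lo≤ , ≤hi ← bounds 0 (s≤s z≤n) =
  lo≤ ∷ increasing-applyUpTo (g ∘ suc) k ≤hi
    (λ j j<k → mono (s≤s z≤n) (s≤s j<k) , proj₂ (bounds (suc j) (s≤s j<k)))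
    (λ i<j j<k → mono (s≤s i<j) (s≤s j<k))

-- The default will be `suc m`: it supplies the forced hole of column `n` when that column is short,
-- and all holes for the empty word.
entry : ℕ → List ℕ → ℕ → ℕ
entry d []      _       = d
entry d (x ∷ w) zero    = x
entry d (x ∷ w) (suc j) = entry d w j

entry-lower : ∀ {hi lo w} → Increasing hi lo w → ∀ j → lo ≤ entry hi w j
entry-lower ([] p)  j       = p
entry-lower (p ∷ i) zero    = p
entry-lower (p ∷ i) (suc j) = ≤-trans p (entry-lower i j)

entry-upper : ∀ {hi lo w} → Increasing hi lo w → ∀ j → entry hi w j ≤ hi
entry-upper ([] p)  j       = ≤-refl
entry-upper (p ∷ i) zero    = increasing-bounds i
entry-upper (p ∷ i) (suc j) = entry-upper i j

entry-mono : ∀ {hi lo w} → Increasing hi lo w → ∀ {j k} → j ≤ k → entry hi w j ≤ entry hi w k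
entry-mono ([] p)  _                       = ≤-refl
entry-mono (p ∷ i) {k = zero} z≤n          = ≤-refl
entry-mono (p ∷ i) {k = suc k} z≤n         = entry-lower i k
entry-mono (p ∷ i) (s≤s j≤k)               = entry-mono i j≤k

entry-beyond : ∀ d w {j} → length w ≤ j → entry d w j ≡ d
entry-beyond d []      _       = refl
entry-beyond d (x ∷ w) (s≤s p) = entry-beyond d w p

entry-applyUpTo : ∀ d g {k j} → j < k → entry d (applyUpTo g k) j ≡ g j
entry-applyUpTo d g {suc k} {zero}  _       = refl
entry-applyUpTo d g {suc k} {suc j} (s≤s p) = entry-applyUpTo d (g ∘ suc) p

entry-ext : ∀ d w w′ → length w ≡ length w′ → (∀ j → j < length w → entry d w j ≡ entry d w′ j) → w ≡ w′
entry-ext d []      []        _ _ = refl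
entry-ext d (x ∷ w) (x′ ∷ w′) l e =
  cong₂ _∷_ (e 0 (s≤s z≤n)) (entry-ext d w w′ (suc-injective l) λ j p → e (suc j) (s≤s p))

-- The weakly increasing lists of length k with entries between lo and lo + a.
increasing : ℕ → ℕ → ℕ → List (List ℕ)
increasing zero    a       lo = [] ∷ []
increasing (suc k) zero    lo = map (lo ∷_) (increasing k zero lo)
increasing (suc k) (suc a) lo = map (lo ∷_) (increasing k (suc a) lo) ++ increasing (suc k) a (suc lo)

-- Pascal's rule: a list either starts with `lo` or has all its entries above `lo`.
length-increasing : ∀ k a lo → length (increasing k a lo) ≡ (k + a) C k
length-increasing zero    a       lo = refl
length-increasing (suc k) zero    lo = begin
  length (map (lo ∷_) (increasing k 0 lo)) ≡⟨ length-map (lo ∷_) (increasing k 0 lo) ⟩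
  length (increasing k 0 lo)               ≡⟨ length-increasing k 0 lo ⟩
  (k + 0) C k                              ≡⟨ cong (_C k) (+-identityʳ k) ⟩
  k C k                                    ≡⟨ nCn≡1 k ⟩
  1                                        ≡⟨ nCn≡1 (suc k) ⟨
  suc k C suc k                            ≡⟨ cong (λ x → suc x C suc k) (+-identityʳ k) ⟨
  suc (k + 0) C suc k                      ∎
  where open ≡-Reasoning
length-increasing (suc k) (suc a) lo = begin
  length (map (lo ∷_) starting ++ later)        ≡⟨ length-++ (map (lo ∷_) starting) ⟩
  length (map (lo ∷_) starting) + length later  ≡⟨ cong (_+ length later) (length-map (lo ∷_) starting) ⟩
  length starting + length later
    ≡⟨ cong₂ _+_ (length-increasing k (suc a) lo) (length-increasing (suc k) a (suc lo)) ⟩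
  (k + suc a) C k + suc (k + a) C suc k ≡⟨ cong (λ x → (k + suc a) C k + x C suc k) (+-suc k a) ⟨
  (k + suc a) C k + (k + suc a) C suc k ≡⟨ nCk+nC[k+1]≡[n+1]C[k+1] (k + suc a) k ⟩
  suc (k + suc a) C suc k               ∎
  where
  open ≡-Reasoning
  starting = increasing k (suc a) lo
  later = increasing (suc k) a (suc lo)

increasing-sound : ∀ k a lo {w} → w ∈ increasing k a lo → Increasing (lo + a) lo w × length w ≡ k
increasing-sound zero    a       lo (here refl) = [] (m≤m+n lo a) , refl
increasing-sound (suc k) zero    lo p
  with w , w∈ , refl ← ∈-map⁻ (lo ∷_) p
  with i , l ← increasing-sound k zero lo w∈ = ≤-refl ∷ i , cong suc l
increasing-sound (suc k) (suc a) lo {w} p with ∈-++⁻ (map (lo ∷_) (increasing k (suc a) lo)) p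
... | inj₁ q with _ , w∈ , refl ← ∈-map⁻ (lo ∷_) q
  with i , l ← increasing-sound k (suc a) lo w∈ = ≤-refl ∷ i , cong suc l
... | inj₂ q with i , l ← increasing-sound (suc k) a (suc lo) q =
  increasing-lower (n≤1+n lo) (subst (λ hi → Increasing hi (suc lo) w) (sym (+-suc lo a)) i) , l

increasing-complete : ∀ k a lo {w} → Increasing (lo + a) lo w → length w ≡ k → w ∈ increasing k a lo
increasing-complete zero    a       lo ([] _)  _ = here refl
increasing-complete (suc k) zero    lo {x ∷ w} (p ∷ i) l =
  subst (λ y → y ∷ w ∈ increasing (suc k) 0 lo)
    (≤-antisym p (≤-trans (increasing-bounds i) (≤-reflexive (+-identityʳ lo))))
    (∈-map⁺ (lo ∷_) (increasing-complete k zero lo (increasing-lower p i) (suc-injective l)))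
increasing-complete (suc k) (suc a) lo {x ∷ w} (p ∷ i) l =
  [ (λ lo<x → ∈-++⁺ʳ (map (lo ∷_) (increasing k (suc a) lo))
      (increasing-complete (suc k) a (suc lo)
        (lo<x ∷ subst (λ hi → Increasing hi x w) (+-suc lo a) i) l))
  , (λ lo≡x → subst (λ y → y ∷ w ∈ increasing (suc k) (suc a) lo) lo≡x
      (∈-++⁺ˡ (∈-map⁺ (lo ∷_) (increasing-complete k (suc a) lo (increasing-lower p i) (suc-injective l)))))
  ]′ (m≤n⇒m<n∨m≡n p)

increasing-unique : ∀ k a lo → Unique (increasing k a lo)
increasing-unique zero    a       lo = [] ∷ []
increasing-unique (suc k) zero    lo = Unique.map⁺ ∷-injectiveʳ (increasing-unique k zero lo)
increasing-unique (suc k) (suc a) lo = Unique.++⁺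
  (Unique.map⁺ ∷-injectiveʳ (increasing-unique k (suc a) lo))
  (increasing-unique (suc k) a (suc lo)) disjoint
  where
  disjoint : ∀ {w} → ¬ (w ∈ map (lo ∷_) (increasing k (suc a) lo) × w ∈ increasing (suc k) a (suc lo))
  disjoint (p , q) with _ , _ , refl ← ∈-map⁻ (lo ∷_) p with (lt ∷ _) , _ ← increasing-sound (suc k) a (suc lo) q
    = <-irrefl refl lt

-- Carries distinctness of words over to diagrams, where injectivity is available under the
-- predicate `Word`.
allPairs-restrict : ∀ {A : Set} {P : A → Set} {R S : A → A → Set} {xs} →
  (∀ {x y} → P x → P y → R x y → S x y) → All P xs → AllPairs R xs → AllPairs S xs
allPairs-restrict f [] [] = []
allPairs-restrict f (px ∷ pxs) (rx ∷ rxs) =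
  All.zipWith (λ (py , r) → f px py r) (pxs , rx) ∷ allPairs-restrict f pxs rxs

-- Two rows at a time: of two consecutive rows exactly one is odd.
count-odd : ∀ n → count (alternating false) n ≡ ⌈ n /2⌉
count-even : ∀ n → count (not ∘ alternating false) n ≡ ⌊ n /2⌋
count-odd zero = refl
count-odd (suc zero) = refl
count-odd (2+ n) with alternating false n
... | true  = cong suc (count-odd n)
... | false = cong suc (count-odd n)
count-even zero = refl
count-even (suc zero) = refl
count-even (2+ n) with alternating false n
... | true  = cong suc (count-even n)
... | false = cong suc (count-even n)

-- Structure and number of the minimal diagrams.

module Minimal (b : Bool) (n : ℕ) {D₀ : Diagram} (init : ∀ s c → mem D₀ s c ≡ Checkered.checkered b n s c) where

  open Checkered b n

  checkered-count-long : ∀ c → inside n c ≡ true → long c ≡ true → count (λ s → checkered s c) n ≡ M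
  checkered-count-long c i l = trans (count-cong n agrees) (count-odd n)
    where
    agrees : ∀ s → 1 ≤ s → s ≤ n → checkered s c ≡ alternating false s
    agrees s p q rewrite inside⁺ p q | i | l with alternating false s
    ... | true  = refl
    ... | false = refl

  checkered-count-short : ∀ c → inside n c ≡ true → long c ≡ false → count (λ s → checkered s c) n ≡ m
  checkered-count-short c i l = trans (count-cong n agrees) (count-even n)
    where
    agrees : ∀ s → 1 ≤ s → s ≤ n → checkered s c ≡ not (alternating false s)
    agrees s p q rewrite inside⁺ p q | i | l with alternating false s
    ... | true  = refl
    ... | false = refl

  checkered-count-outside : ∀ c → inside n c ≡ false → count (λ s → checkered s c) n ≡ 0
  checkered-count-outside c i = count-empty _ n λ s _ _ →
    trans (cong (λ x → inside n s ∧ (x ∧ not (alternating false s xor long c))) i) (∧-zeroʳ _)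

  checkered-count-≤ : ∀ c → count (λ s → checkered s c) n ≤ M
  checkered-count-≤ c = by-cases (inside n c) (long c) refl refl
    where
    by-cases : ∀ i l → inside n c ≡ i → long c ≡ l → count (λ s → checkered s c) n ≤ M
    by-cases false _     i _ = ≤-trans (≤-reflexive (checkered-count-outside c i)) z≤n
    by-cases true  true  i l = ≤-reflexive (checkered-count-long c i l)
    by-cases true  false i l = ≤-trans (≤-reflexive (checkered-count-short c i l)) m≤M

  init-rows : RowsWithin n D₀
  init-rows s c p = inside⁻ {n} (proj₁ (∧-true {inside n s} (trans (sym (init s c)) p)))

  module Reached {D : Diagram} (min : IsMin D₀ D) where

    private
      -- The list actually reached by moves; it has the members of `D`, and the invariants pass to
      -- `D` through `mem-E`.
      E = proj₁ (proj₁ min)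
      D₀⇝E : D₀ ⇝ E
      D₀⇝E = proj₁ (proj₂ (proj₁ min))
      mem-E : ∀ s c → mem E s c ≡ mem D s c
      mem-E = ≈D⇒mem (proj₂ (proj₂ (proj₁ min)))

    stable : Stable D
    stable = IsMin⇒Stable min

    rows : RowsWithin n D
    rows s c p = ⇝-rowsWithin D₀⇝E init-rows s c (trans (mem-E s c) p)

    total : ∀ c → count (column D c) n ≡ count (λ s → checkered s c) n
    total c = begin
      count (column D c) n            ≡⟨ count-cong n (λ s _ _ → mem-E s c) ⟨
      count (column E c) n            ≡⟨ ⇝-count D₀⇝E init-rows c ⟩
      count (column D₀ c) n           ≡⟨ count-cong n (λ s _ _ → init s c) ⟩
      count (λ s → checkered s c) n   ∎
      where open ≡-Reasoning

    -- Any two short columns of the initial diagram are equal, so dominance holds at the start.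
    dominated : ∀ {c c′} → c < c′ → inside n c ≡ true → inside n c′ ≡ true →
      long c ≡ false → long c′ ≡ false → Dominated (column D c) (column D c′)
    dominated {c} {c′} c<c′ i i′ l l′ k =
      subst₂ _≤_ (count-cong k λ s _ _ → mem-E s c) (count-cong k λ s _ _ → mem-E s c′)
        (⇝-dominated D₀⇝E c<c′ (λ k → ≤-reflexive (count-cong k λ s _ _ →
          trans (init s c) (trans (same s) (sym (init s c′))))) k)
      where
      same : ∀ s → checkered s c ≡ checkered s c′
      same s rewrite i | i′ | l | l′ = refl

    -- The rightmost cell of a row sits on top of a full column.
    height : ∀ {r c} → mem D r c ≡ true → r ≤ M
    height {r} {c} p with c′ , R ← rightmost-exists p = begin
      r                              ≡⟨ count-full (column D c′) r filled ⟨
      count (column D c′) r          ≤⟨ count-mono (column D c′) (proj₂ (rows r c p)) ⟩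
      count (column D c′) n          ≡⟨ total c′ ⟩
      count (λ s → checkered s c′) n ≤⟨ checkered-count-≤ c′ ⟩
      M                              ∎
      where
      open ≤-Reasoning
      filled : ∀ s → 1 ≤ s → s ≤ r → mem D s c′ ≡ true
      filled s 1≤s s≤r with m≤n⇒m<n∨m≡n s≤r
      ... | inj₁ s<r = stable R s 1≤s s<r
      ... | inj₂ refl = proj₁ R

    above : ∀ {s} c → M < s → mem D s c ≡ false
    above c M<s = ≢true⇒false λ p → <⇒≱ M<s (height p)

    total-M : ∀ c → count (column D c) M ≡ count (λ s → checkered s c) n
    total-M c = trans (sym (count-stationary (column D c) (⌈n/2⌉≤n n) λ s p _ → above c p)) (total c)

    long-full : ∀ {c} → inside n c ≡ true → long c ≡ true → ∀ s → 1 ≤ s → s ≤ M → mem D s c ≡ true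
    long-full {c} i l = count-full⁻ (column D c) M (trans (total-M c) (checkered-count-long c i l))

    outside-empty : ∀ {c} → inside n c ≡ false → ∀ s → mem D s c ≡ false
    outside-empty {c} i s = ≢true⇒false λ p → true≢false p
      (count-empty⁻ (column D c) n (trans (total c) (checkered-count-outside c i)) s
        (proj₁ (rows s c p)) (proj₂ (rows s c p)))

    module _ (h : ℕ → ℕ) where
      open Profile h

      -- Outside the short columns nothing is left to choose: long columns are full up to `M`, and
      -- no cell lies above `M` or outside the first `n` columns.
      matches-target : (∀ c → inside n c ≡ true → long c ≡ false →
        ∀ s → 1 ≤ s → s ≤ suc m → mem D s c ≡ not (h c ≡ᵇ s)) → ∀ s c → mem D s c ≡ target s c
      matches-target short s c with inside n c in i
      ... | false = outside-empty i s
      ... | true with 1 ≤? s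
      ...   | no 1≰s rewrite ≰ᵇ⁺ (≰⇒> 1≰s) = ≢true⇒false λ p → 1≰s (proj₁ (rows s c p))
      ...   | yes 1≤s rewrite ≤ᵇ⁺ 1≤s with long c in l
      ...     | true with s ≤? M
      ...       | yes s≤M rewrite ≤ᵇ⁺ s≤M = long-full i l s 1≤s s≤M
      ...       | no s≰M rewrite ≰ᵇ⁺ (≰⇒> s≰M) = above c (≰⇒> s≰M)
      matches-target short s c | true | yes 1≤s | false with s ≤? suc m
      ...       | yes s≤ rewrite ≤ᵇ⁺ s≤ = short c i l s 1≤s s≤
      ...       | no s≰ rewrite ≰ᵇ⁺ (≰⇒> s≰) = above c (≤-<-trans M≤1+m (≰⇒> s≰))

    module Odd (odd : M ≡ suc m) where

      hole-at : ℕ → ℕ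
      hole-at c = hole (column D c) (suc m)

      one-hole : ∀ {c} → inside n c ≡ true → long c ≡ false → OneHole (column D c) (suc m) (hole-at c)
      one-hole {c} i l = hole-spec (column D c) m
        (trans (cong (count (column D c)) (sym odd)) (trans (total-M c) (checkered-count-short c i l)))

      hole-at-mono : ∀ {c c′} → c < c′ → inside n c ≡ true → inside n c′ ≡ true →
        long c ≡ false → long c′ ≡ false → hole-at c ≤ hole-at c′
      hole-at-mono c<c′ i i′ l l′ = hole-mono (one-hole i l) (one-hole i′ l′) (dominated c<c′ i i′ l l′)

      -- With a lower hole, column `n` would have a cell in row `suc m`. Nothing lies to its right,
      -- so stability would fill the hole.
      hole-at-last : inside n n ≡ true → long n ≡ false → hole-at n ≡ suc m
      hole-at-last i l with m≤n⇒m<n∨m≡n (OneHole.bounded (one-hole i l))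
      ... | inj₂ e = e
      ... | inj₁ lt = ⊥-elim (true≢false
        (stable (top , λ c′ n<c′ → outside-empty (outside⁺ n<c′) (suc m)) (hole-at n)
          (OneHole.positive (one-hole i l)) lt)
        (OneHole.vacant (one-hole i l)))
        where
        top : mem D (suc m) n ≡ true
        top = OneHole.others (one-hole i l) (suc m) (s≤s z≤n) ≤-refl (≢-sym (<⇒≢ lt))

      matches-holes : ∀ h → (∀ c → inside n c ≡ true → long c ≡ false → h c ≡ hole-at c) →
        ∀ s c → mem D s c ≡ Profile.target h s c
      matches-holes h e = matches-target h short
        where
        short : ∀ c → inside n c ≡ true → long c ≡ false →
          ∀ s → 1 ≤ s → s ≤ suc m → mem D s c ≡ not (h c ≡ᵇ s)
        short c i l s 1≤s s≤ with h c ≟ s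
        ... | yes refl rewrite ≡ᵇ⁺ {h c} refl =
          trans (cong (column D c) (e c i l)) (OneHole.vacant (one-hole i l))
        ... | no h≢s rewrite ≢ᵇ⁺ h≢s =
          OneHole.others (one-hole i l) s 1≤s s≤ λ s≡ → h≢s (trans (e c i l) (sym s≡))

    module Even (even : M ≡ m) where

      -- Here a short column has `m` cells in `m` rows and is full; the hole at `suc m` is the
      -- position just above it.
      matches-full : ∀ s c → mem D s c ≡ Profile.target (λ _ → suc m) s c
      matches-full = matches-target (λ _ → suc m) short
        where
        short : ∀ c → inside n c ≡ true → long c ≡ false →
          ∀ s → 1 ≤ s → s ≤ suc m → mem D s c ≡ not (suc m ≡ᵇ s)
        short c i l s 1≤s s≤ with m≤n⇒m<n∨m≡n s≤
        ... | inj₂ refl rewrite ≡ᵇ⁺ {suc m} refl = above c (s≤s (≤-reflexive even))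
        ... | inj₁ s<1+m rewrite ≢ᵇ⁺ (≢-sym (<⇒≢ s<1+m)) = count-full⁻ (column D c) M
          (trans (total-M c) (trans (checkered-count-short c i l) (sym even)))
          s 1≤s (≤-trans (s≤s⁻¹ s<1+m) (≤-reflexive (sym even)))

  -- The number of short columns to the left of a short column c, for either value of b.
  index : ℕ → ℕ
  index c = ⌊ c ∸ 1 /2⌋

  index-mono : ∀ {c c′} → c ≤ c′ → index c ≤ index c′
  index-mono p = ⌊n/2⌋-mono (∸-monoˡ-≤ 1 p)

  holes : List ℕ → ℕ → ℕ
  holes w c = entry (suc m) w (index c)

  diagram : List ℕ → Diagram
  diagram w = Profile.final-diagram (holes w)

  even-minCard : M ≡ m → MinCard D₀ 1
  -- The empty word gives the constant hole function `suc m` by computation.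
  even-minCard even = diagram [] ∷ [] , refl , isMin ∷ [] , [] ∷ [] , λ D min →
    here (mem⇒≈D λ s c → trans (Reached.Even.matches-full min even s c)
      (sym (Profile.mem-final-diagram (λ _ → suc m) s c)))
    where
    isMin : IsMin D₀ (diagram [])
    isMin = Profile.final-diagram-IsMin (λ _ → suc m) (record
      { positive = λ _ → s≤s z≤n ; bounded = λ _ → ≤-refl ; monotone = λ _ → ≤-refl
      ; last = refl ; low = λ _ p → ⊥-elim (<⇒≱ ≤-refl p) }) init

  module OddSize (odd : M ≡ suc m) where

    n≡1+2m : n ≡ suc (m + m)
    n≡1+2m = trans (sym m+M≡n) (trans (cong (m +_) odd) (+-suc m m))

    index-n : index n ≡ m
    index-n = trans (cong index n≡1+2m) (sym (n≡⌊n+n/2⌋ m))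

    -- The short columns, counted from 0; inverse to `index` on them. They are the odd columns if
    -- `b` is true and the even ones otherwise.
    shortColumn : ℕ → ℕ
    shortColumn j = (if b then 1 else 2) + (j + j)

    shortColumn-suc : ∀ j → shortColumn (suc j) ≡ 2+ (shortColumn j)
    shortColumn-suc j = shifted b
      where
      shifted : ∀ b → (if b then 1 else 2) + (suc j + suc j) ≡ 2+ ((if b then 1 else 2) + (j + j))
      shifted true  = cong 2+ (+-suc j j)
      shifted false = cong (3 +_) (+-suc j j)

    shortColumn-short : ∀ j → long (shortColumn j) ≡ false
    shortColumn-short j = at-offset b
      where
      at-offset : ∀ b → alternating b ((if b then 1 else 2) + (j + j)) ≡ false
      at-offset true  = cong not (alternating-double true j)
      at-offset false = cong (not ∘ not) (alternating-double false j)

    shortColumn-positive : ∀ j → suc (j + j) ≤ shortColumn j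
    shortColumn-positive j = +-monoˡ-≤ (j + j) (positive b)
      where
      positive : ∀ b → 1 ≤ (if b then 1 else 2)
      positive true  = s≤s z≤n
      positive false = s≤s z≤n

    shortColumn-upper : ∀ j → shortColumn j ≤ 2+ (j + j)
    shortColumn-upper j = +-monoˡ-≤ (j + j) (upper b)
      where
      upper : ∀ b → (if b then 1 else 2) ≤ 2
      upper true  = s≤s z≤n
      upper false = ≤-refl

    shortColumn-inside : ∀ {j} → j < m → inside n (shortColumn j) ≡ true
    shortColumn-inside {j} j<m = inside⁺ (≤-trans (s≤s z≤n) (shortColumn-positive j))
      (≤-trans (shortColumn-upper j) (subst₂ _≤_ (cong suc (+-suc j j)) (sym n≡1+2m)
        (m≤n⇒m≤1+n (+-mono-≤ j<m j<m))))

    shortColumn-< : ∀ {i j} → i < j → shortColumn i < shortColumn j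
    shortColumn-< i<j = +-monoʳ-< (if b then 1 else 2) (+-mono-< i<j i<j)

    index-shortColumn : ∀ j → index (shortColumn j) ≡ j
    index-shortColumn j = inverse b
      where
      inverse : ∀ b → index ((if b then 1 else 2) + (j + j)) ≡ j
      inverse true  = sym (n≡⌊n+n/2⌋ j)
      inverse false = sym (n≡⌈n+n/2⌉ j)

    shortColumn-index : ∀ {c} → 1 ≤ c → long c ≡ false → shortColumn (index c) ≡ c
    shortColumn-index {suc zero} _ l = first b l
      where
      first : ∀ b → not b ≡ false → (if b then 1 else 2) + 0 ≡ 1
      first true _ = refl
    shortColumn-index {2+ zero} _ l = second b l
      where
      second : ∀ b → not (not b) ≡ false → (if b then 1 else 2) + 0 ≡ 2
      second false _ = refl
    shortColumn-index {2+ (suc c)} _ l = trans (shortColumn-suc (index (suc c)))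
      (cong 2+ (shortColumn-index (s≤s z≤n) (trans (sym (not-involutive (long (suc c)))) l)))

    -- One entry for each of the first `m` short columns, with values in the rows from 1 to `suc m`.
    words : List (List ℕ)
    words = increasing m m 1

    Word : List ℕ → Set
    Word w = Increasing (suc m) 1 w × length w ≡ m

    admissible : ∀ {w} → Word w → Profile.Admissible (holes w)
    admissible {w} (i , l) = record
      { positive = λ c → entry-lower i (index c)
      ; bounded  = λ c → entry-upper i (index c)
      ; monotone = λ p → entry-mono i (index-mono p)
      -- The index of column `n` equals the length of the word, so the default is returned.
      ; last     = entry-beyond (suc m) w (≤-reflexive (trans l (sym index-n)))
      ; low      = λ _ _ → odd }

    -- Both diagrams are tested at the hole of `w` in each short column: it is vacant in the second
    -- one too, hence is its hole.
    diagram-injective : ∀ {w w′} → Word w → Word w′ → diagram w ≈D diagram w′ → w ≡ w′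
    diagram-injective {w} {w′} (i , l) (_ , l′) e =
      entry-ext (suc m) w w′ (trans l (sym l′)) λ j j<l → same-entry (subst (j <_) l j<l)
      where
      same-entry : ∀ {j} → j < m → entry (suc m) w j ≡ entry (suc m) w′ j
      same-entry {j} j<m = subst (λ x → entry (suc m) w x ≡ entry (suc m) w′ x) (index-shortColumn j) same-hole
        where
        c = shortColumn j
        hw = holes w c
        same : Profile.target (holes w) hw c ≡ Profile.target (holes w′) hw c
        same = trans (sym (Profile.mem-final-diagram (holes w) hw c))
          (trans (≈D⇒mem e hw c) (Profile.mem-final-diagram (holes w′) hw c))
        target-at-hw : ∀ w″ → Profile.target (holes w″) hw c ≡ not (holes w″ c ≡ᵇ hw)
        target-at-hw w″ rewrite shortColumn-inside j<m | shortColumn-short j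
          | ≤ᵇ⁺ (entry-lower i (index c)) | ≤ᵇ⁺ (entry-upper i (index c)) = refl
        same-hole : holes w c ≡ holes w′ c
        same-hole with holes w′ c ≟ hw
        ... | yes p = sym p
        ... | no p with () ← trans (sym (cong not (≡ᵇ⁺ {hw} refl)))
          (trans (trans (sym (target-at-hw w)) (trans same (target-at-hw w′))) (cong not (≢ᵇ⁺ p)))

    -- The word lists the holes of the first `m` short columns. A further short column can only be
    -- column `n`, whose hole is forced.
    word-of : ∀ {D} → IsMin D₀ D → ∃[ w ] (Word w × D ≈D diagram w)
    word-of {D} min = w , (incr , length-applyUpTo (hole-at ∘ shortColumn) m)
      , mem⇒≈D λ s c → trans (matches-holes (holes w) agrees s c) (sym (Profile.mem-final-diagram (holes w) s c))
      where
      open Reached min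
      open Odd odd
      w = applyUpTo (hole-at ∘ shortColumn) m
      incr : Increasing (suc m) 1 w
      incr = increasing-applyUpTo (hole-at ∘ shortColumn) m (s≤s z≤n)
        (λ j j<m → let H = one-hole (shortColumn-inside j<m) (shortColumn-short j)
                   in OneHole.positive H , OneHole.bounded H)
        (λ {i} {j} i<j j<m → hole-at-mono (shortColumn-< i<j)
          (shortColumn-inside (<-trans i<j j<m)) (shortColumn-inside j<m)
          (shortColumn-short i) (shortColumn-short j))
      agrees : ∀ c → inside n c ≡ true → long c ≡ false → holes w c ≡ hole-at c
      agrees c i l with 1≤c , c≤n ← inside⁻ {n} i
        with m≤n⇒m<n∨m≡n (≤-trans (index-mono c≤n) (≤-reflexive index-n))
      ... | inj₁ lt = trans (entry-applyUpTo (suc m) (hole-at ∘ shortColumn) lt)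
        (cong hole-at (shortColumn-index 1≤c l))
      ... | inj₂ e = trans (entry-beyond (suc m) w
          (≤-reflexive (trans (length-applyUpTo (hole-at ∘ shortColumn) m) (sym e)))) (sym last)
        where
        -- A short column of index `m` is at least `1 + 2m`, that is, at least `n`.
        c≡n : c ≡ n
        c≡n = ≤-antisym c≤n (begin
          n                      ≡⟨ n≡1+2m ⟩
          suc (m + m)            ≤⟨ shortColumn-positive m ⟩
          shortColumn m          ≡⟨ cong shortColumn e ⟨
          shortColumn (index c)  ≡⟨ shortColumn-index 1≤c l ⟩
          c                      ∎)
          where open ≤-Reasoning
        last : hole-at c ≡ suc m
        last = trans (cong hole-at c≡n) (hole-at-last (trans (cong (inside n) (sym c≡n)) i)
          (trans (cong long (sym c≡n)) l))

    odd-minCard : MinCard D₀ ((m + m) C m)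
    odd-minCard = map diagram words
      , trans (length-map diagram words) (length-increasing m m 1)
      , All.map⁺ (All.map (λ {w} p → Profile.final-diagram-IsMin (holes w) (admissible p) init) all-words)
      , AllPairs.map⁺ (allPairs-restrict (λ p q w≢w′ e → w≢w′ (diagram-injective p q e))
          all-words (increasing-unique m m 1))
      , λ D min → let w , (i , l) , e = word-of min in
          Any.map⁺ (Any.map (λ { refl → e }) (increasing-complete m m 1 i l))
      where
      all-words : All Word words
      all-words = All.tabulate (increasing-sound m m 1)

-- Membership in the checkered diagrams

∈-range1⁺ : ∀ {i k} → i < k → suc i ∈ range1 k
∈-range1⁺ p = ∈-map⁺ suc (∈-upTo⁺ p)

∈-range1⁻ : ∀ {x k} → x ∈ range1 k → ∃[ i ] (i < k × x ≡ suc i)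
∈-range1⁻ p with i , i∈ , refl ← ∈-map⁻ suc p = i , ∈-upTo⁻ i∈ , refl

∈-grid⁺ : ∀ f g {a b i j} → i < a → j < b → (f (suc i) , g (suc j)) ∈ grid f g a b
∈-grid⁺ f g {a} {b} i<a j<b = ∈-concatMap⁺ (λ i → map (λ j → (f i , g j)) (range1 b))
  (lose (∈-range1⁺ i<a) (∈-map⁺ (λ j → (f _ , g j)) (∈-range1⁺ j<b)))

∈-grid⁻ : ∀ f g {a b x} → x ∈ grid f g a b → ∃[ i ] ∃[ j ] (i < a × j < b × x ≡ (f (suc i) , g (suc j)))
∈-grid⁻ f g {a} {b} p
  with _ , i∈ , q ← find (∈-concatMap⁻ (λ i → map (λ j → (f i , g j)) (range1 b)) {xs = range1 a} p)
  with _ , j∈ , refl ← ∈-map⁻ _ q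
  with i , i<a , refl ← ∈-range1⁻ i∈
  with j , j<b , refl ← ∈-range1⁻ j∈ = i , j , i<a , j<b , refl

-- Treats the rows and columns of both checkered diagrams alike. The argument `suc i` reflects that
-- `range1` starts at 1.
record Enumerates (n : ℕ) (P : ℕ → Bool) (f : ℕ → ℕ) (a : ℕ) : Set where
  field
    sound    : ∀ {i} → i < a → inside n (f (suc i)) ≡ true × P (f (suc i)) ≡ true
    complete : ∀ {k} → inside n k ≡ true → P k ≡ true → ∃[ i ] (i < a × k ≡ f (suc i))

odd′-suc : ∀ i → odd′ (suc i) ≡ suc (i + i)
odd′-suc i = trans (cong (λ x → i + suc x) (+-identityʳ i)) (+-suc i i)

even′-suc : ∀ i → even′ (suc i) ≡ 2+ (i + i)
even′-suc i = cong suc (odd′-suc i)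

alternating-true : ∀ k → alternating true k ≡ true → ∃[ i ] k ≡ i + i
alternating-true zero _ = 0 , refl
alternating-true (2+ k) p with i , refl ← alternating-true k (trans (sym (not-involutive (alternating true k))) p)
  = suc i , cong suc (sym (+-suc i i))

alternating-false : ∀ k → alternating false k ≡ true → ∃[ i ] k ≡ suc (i + i)
alternating-false (suc k) p
  with i , refl ← alternating-true k (trans (alternating-not false k) p) = i , refl

double-<-⌈/2⌉ : ∀ {i n} → suc (i + i) ≤ n → i < ⌈ n /2⌉
double-<-⌈/2⌉ {i} {n} p = ≤-trans (≤-reflexive (cong suc (n≡⌊n+n/2⌋ i))) (⌊n/2⌋-mono (s≤s p))

⌈/2⌉-<-double : ∀ {i n} → i < ⌈ n /2⌉ → suc (i + i) ≤ n
⌈/2⌉-<-double {zero} {suc n} _ = s≤s z≤n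
⌈/2⌉-<-double {suc i} {suc (suc n)} (s≤s p) rewrite +-suc i i = s≤s (s≤s (⌈/2⌉-<-double p))

odd-enumerates : ∀ n → Enumerates n (alternating false) odd′ ⌈ n /2⌉
odd-enumerates n = record
  { sound = λ {i} p → subst (λ k → inside n k ≡ true × alternating false k ≡ true) (sym (odd′-suc i))
      (inside⁺ (s≤s z≤n) (⌈/2⌉-<-double p) , cong not (alternating-double false i))
  ; complete = complete }
  where
  complete : ∀ {k} → inside n k ≡ true → alternating false k ≡ true → ∃[ i ] (i < ⌈ n /2⌉ × k ≡ odd′ (suc i))
  complete {k} p q with i , refl ← alternating-false k q =
    i , double-<-⌈/2⌉ (proj₂ (inside⁻ {n} p)) , sym (odd′-suc i)

even-enumerates : ∀ n → Enumerates n (not ∘ alternating false) even′ ⌊ n /2⌋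
even-enumerates n = record
  { sound = λ {i} p → subst (λ k → inside n k ≡ true × not (alternating false k) ≡ true) (sym (even′-suc i))
      (inside⁺ (s≤s z≤n) (bound p) , trans (not-involutive _) (cong not (alternating-double false i)))
  ; complete = complete }
  where
  bound : ∀ {i n} → i < ⌊ n /2⌋ → 2+ (i + i) ≤ n
  -- `⌊ suc n /2⌋` is `⌈ n /2⌉` by definition, which reduces the even case to the odd one.
  bound {i} {suc n} p = s≤s (⌈/2⌉-<-double p)
  complete : ∀ {k} → inside n k ≡ true → not (alternating false k) ≡ true → ∃[ i ] (i < ⌊ n /2⌋ × k ≡ even′ (suc i))
  complete {zero} p q with () ← proj₁ (inside⁻ {n} p)
  complete {suc k} p q
    with i , refl ← alternating-false k (trans (sym (not-involutive (alternating false k))) q)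
    with s≤s le ← proj₂ (inside⁻ {n} p)
    = i , double-<-⌈/2⌉ le , sym (even′-suc i)

-- The first grid is odd rows against long columns, the second even rows against short ones; cells
-- of mixed type are excluded by the `xor`.
mem-grids : ∀ {n f f′ g g′ a a′ b b′} (b₀ : Bool) →
  Enumerates n (alternating false) f a → Enumerates n (not ∘ alternating false) f′ a′ →
  Enumerates n (alternating b₀) g b → Enumerates n (not ∘ alternating b₀) g′ b′ →
  ∀ s c → mem (grid f g a b ++ grid f′ g′ a′ b′) s c ≡ Checkered.checkered b₀ n s c
mem-grids {n} {f} {f′} {g} {g′} {a} {a′} {b} {b′} b₀ rows rows′ cols cols′ s c = Bool-ext fwd bwd
  where
  open Checkered b₀ n
  fwd : mem (grid f g a b ++ grid f′ g′ a′ b′) s c ≡ true → checkered s c ≡ true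
  fwd p with ∈-++⁻ (grid f g a b) (mem⁻ {grid f g a b ++ grid f′ g′ a′ b′} p)
  ... | inj₁ q with i , j , i<a , j<b , refl ← ∈-grid⁻ f g {a} {b} q
    with r₁ , r₂ ← Enumerates.sound rows i<a with c₁ , c₂ ← Enumerates.sound cols j<b
    rewrite r₁ | c₁ | r₂ | c₂ = refl
  ... | inj₂ q with i , j , i<a , j<b , refl ← ∈-grid⁻ f′ g′ {a′} {b′} q
    with r₁ , r₂ ← Enumerates.sound rows′ i<a with c₁ , c₂ ← Enumerates.sound cols′ j<b
    rewrite r₁ | c₁ = both (alternating false s) (long c) r₂ c₂
    where
    both : ∀ x y → not x ≡ true → not y ≡ true → not (x xor y) ≡ true
    both false false _ _ = refl
  bwd : checkered s c ≡ true → mem (grid f g a b ++ grid f′ g′ a′ b′) s c ≡ true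
  bwd p with p₁ , q ← ∧-true {inside n s} p with q₁ , q₂ ← ∧-true {inside n c} q = mem⁺ (place _ _ refl refl q₂)
    where
    place : ∀ x y → alternating false s ≡ x → long c ≡ y → not (x xor y) ≡ true →
      (s , c) ∈ grid f g a b ++ grid f′ g′ a′ b′
    place true true ex ey _
      with i , i<a , refl ← Enumerates.complete rows p₁ ex
      with j , j<b , refl ← Enumerates.complete cols q₁ ey = ∈-++⁺ˡ (∈-grid⁺ f g i<a j<b)
    place false false ex ey _
      with i , i<a , refl ← Enumerates.complete rows′ p₁ (cong not ex)
      with j , j<b , refl ← Enumerates.complete cols′ q₁ (cong not ey) =
      ∈-++⁺ʳ (grid f g a b) (∈-grid⁺ f′ g′ i<a j<b)

enumerates-cong : ∀ {n P Q f a} → (∀ k → P k ≡ Q k) → Enumerates n P f a → Enumerates n Q f a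
enumerates-cong e En = record
  { sound = λ p → let i , q = Enumerates.sound En p in i , trans (sym (e _)) q
  ; complete = λ i q → Enumerates.complete En i (trans (e _) q) }

mem-Ch¹ : ∀ n s c → mem (Ch¹ n) s c ≡ Checkered.checkered false n s c
mem-Ch¹ n = mem-grids false (odd-enumerates n) (even-enumerates n) (odd-enumerates n) (even-enumerates n)

-- The long columns are now the even ones, so the column enumerations change places, up to rewriting
-- `alternating true` as a negation.
mem-Ch² : ∀ n s c → mem (Ch² n) s c ≡ Checkered.checkered true n s c
mem-Ch² n = mem-grids true (odd-enumerates n) (even-enumerates n)
  (enumerates-cong (λ k → sym (alternating-not false k)) (even-enumerates n))
  (enumerates-cong (λ k → trans (sym (not-involutive _)) (cong not (sym (alternating-not false k)))) (odd-enumerates n))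

-- Parity of the size and the final count.

even⇒⌈n/2⌉ : ∀ n → n % 2 ≡ 0 → ⌈ n /2⌉ ≡ ⌊ n /2⌋
even⇒⌈n/2⌉ zero   _ = refl
even⇒⌈n/2⌉ (2+ n) p = cong suc (even⇒⌈n/2⌉ n p)

odd⇒⌈n/2⌉ : ∀ n → n % 2 ≡ 1 → ⌈ n /2⌉ ≡ suc ⌊ n /2⌋
odd⇒⌈n/2⌉ (suc zero) _ = refl
odd⇒⌈n/2⌉ (2+ n)     p = cong suc (odd⇒⌈n/2⌉ n p)

checkered-minCard : ∀ b n {D₀} → (∀ s c → mem D₀ s c ≡ Checkered.checkered b n s c) →
  (n % 2 ≡ 0 → MinCard D₀ 1) × (n % 2 ≡ 1 → MinCard D₀ ((2 * ⌊ n /2⌋) C ⌊ n /2⌋))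
checkered-minCard b n {D₀} init =
  (λ even → Minimal.even-minCard b n init (even⇒⌈n/2⌉ n even)) ,
  -- The product `2 * ⌊ n /2⌋` computes to a sum whose second term still has a `+ 0`.
  (λ odd → subst (λ k → MinCard D₀ ((⌊ n /2⌋ + k) C ⌊ n /2⌋)) (sym (+-identityʳ ⌊ n /2⌋))
    (Minimal.OddSize.odd-minCard b n init (odd⇒⌈n/2⌉ n odd)))

theorem7p2 : (n : ℕ) → 1 ≤ n → (D₀ : Diagram) → (D₀ ≡ Ch¹ n ⊎ D₀ ≡ Ch² n) →
    ((n % 2 ≡ 0 → MinCard D₀ 1) ×
    (n % 2 ≡ 1 → MinCard D₀ ((2 * ⌊ n /2⌋) C ⌊ n /2⌋)))
theorem7p2 n _ _ (inj₁ refl) = checkered-minCard false n (mem-Ch¹ n)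
theorem7p2 n _ _ (inj₂ refl) = checkered-minCard true n (mem-Ch² n)
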